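{- There exists a constant $c_0<1$ such that for every positive integer $n$, every intersecting set $S\subseteq\mathrm{AGL}(n,2)$ with $|S|\ge c_0|\mathrm{GL}(n,2)|$ is contained in a canonical intersecting set of $\mathrm{AGL}(n,2)$, i.e. there exist $\alpha,\beta\in\mathbb{F}_2^n$ with $S\subseteq\{g: g(\alpha)=\beta\}$.
   Context: $\mathrm{AGL}(n,2)=\mathrm{GL}(n,2)\ltimes V$, $V=\mathbb{F}_2^n$, with elements $(M,v)$, product $(M_1,v_1)(M_2,v_2)=(M_1M_2,v_1+M_1v_2)$, acting on $V$ by $(M,v)\cdot w=v+Mw$. Two elements $g_1,g_2$ are intersecting if $g_1g_2^{ -1}$ fixes a point of $V$; an intersecting set is a set of pairwise intersecting elements. Canonical intersecting sets are the sets $\{g: g(\alpha)=\beta\}$, $\alpha,\beta\in V$ (each of size $|\mathrm{GL}(n,2)|$). -}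

module Defs where

open import Data.Bool using (Bool; true; false; _xor_; _∧_; _≟_)
open import Data.Nat using (ℕ; zero; suc)
open import Data.Fin using (Fin)
import Data.Fin as Fin
open import Data.Vec using (Vec; []; _∷_; map; zipWith; foldr; transpose; tabulate)
open import Data.Vec.Properties using (≡-dec)
open import Data.List using (List; length; concatMap)
open import Data.Bool.ListAction using (any)
import Data.List as List
open import Data.List.Membership.Propositional using (_∈_)
open import Data.Product using (Σ; ∃; _×_; _,_; proj₁; proj₂)
open import Relation.Binary.PropositionalEquality using (_≡_)
open import Relation.Nullary using (Dec; ⌊_⌋)
open import Relation.Binary.Definitions using (DecidableEquality)

-- The field F₂ is modelled by Bool: addition = xor, multiplication = ∧.
F2 : Set
F2 = Bool

Vect : ℕ → Set
Vect n = Vec F2 n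

-- n×n matrices over F₂, as a vector of rows.
Mat : ℕ → Set
Mat n = Vec (Vec F2 n) n

_+ᵥ_ : ∀ {n} → Vect n → Vect n → Vect n
u +ᵥ v = zipWith _xor_ u v

dot : ∀ {n} → Vect n → Vect n → F2
dot u v = foldr _ _xor_ false (zipWith _∧_ u v)

_·ᵥ_ : ∀ {n} → Mat n → Vect n → Vect n
M ·ᵥ w = map (λ row → dot row w) M

_·ₘ_ : ∀ {n} → Mat n → Mat n → Mat n
M ·ₘ N = map (λ row → map (dot row) (transpose N)) M

idMat : ∀ n → Mat n
idMat n = tabulate λ i → tabulate λ j → ⌊ i Fin.≟ j ⌋

zeroVec : ∀ n → Vect n
zeroVec n = tabulate λ _ → false

Invertible : ∀ {n} → Mat n → Set
Invertible {n} M = Σ (Mat n) λ N → (M ·ₘ N ≡ idMat n) × (N ·ₘ M ≡ idMat n)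

Aff : ℕ → Set
Aff n = Mat n × Vect n

IsAGL : ∀ {n} → Aff n → Set
IsAGL (M , _) = Invertible M

_∙_ : ∀ {n} → Aff n → Aff n → Aff n
(M₁ , v₁) ∙ (M₂ , v₂) = (M₁ ·ₘ M₂ , v₁ +ᵥ (M₁ ·ᵥ v₂))

identity : ∀ n → Aff n
identity n = (idMat n , zeroVec n)

act : ∀ {n} → Aff n → Vect n → Vect n
act (M , v) w = v +ᵥ (M ·ᵥ w)

-- g₁ and g₂ are intersecting: g₁ g₂⁻¹ fixes a point of V
-- (h is the (unique) inverse of g₂ in AGL(n,2)).
Intersecting : ∀ {n} → Aff n → Aff n → Set
Intersecting {n} g₁ g₂ =
  Σ (Aff n) λ h → (h ∙ g₂ ≡ identity n) × (g₂ ∙ h ≡ identity n) ×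
    ∃ λ w → act (g₁ ∙ h) w ≡ w

IntersectingSet : ∀ {n} → List (Aff n) → Set
IntersectingSet S = ∀ {g₁ g₂} → g₁ ∈ S → g₂ ∈ S → Intersecting g₁ g₂

vecsOver : ∀ {A : Set} → List A → (m : ℕ) → List (Vec A m)
vecsOver xs zero = List.[ [] ]
vecsOver xs (suc m) = concatMap (λ x → List.map (x ∷_) (vecsOver xs m)) xs

allMats : ∀ n → List (Mat n)
allMats n = vecsOver (vecsOver (true List.∷ false List.∷ List.[]) n) n

matDec : ∀ {n} → DecidableEquality (Mat n)
matDec = ≡-dec (≡-dec _≟_)

invertibleᵇ : ∀ {n} → Mat n → Bool
invertibleᵇ {n} M = any (λ N → ⌊ matDec (M ·ₘ N) (idMat n) ⌋ ∧ ⌊ matDec (N ·ₘ M) (idMat n) ⌋) (allMats n)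

countᵇ : ∀ {A : Set} → (A → Bool) → List A → ℕ
countᵇ p List.[] = zero
countᵇ p (x List.∷ xs) with p x
... | true = suc (countᵇ p xs)
... | false = countᵇ p xs

glOrder : ℕ → ℕ
glOrder n = countᵇ invertibleᵇ (allMats n)

{-# OPTIONS --safe #-}
-- Let S be a family of (M , v) and call φ (a , x) the value a · v for any (M , v) ∈ S with a M = x:
-- S is intersecting exactly when this does not depend on the choice, so S has at most one element
-- over each M ∈ GL(n,2).  Linearity of a ↦ a · v gives φ (a + b , x + y) = φ (a , x) + φ (b , y)
-- whenever some M in S maps a to x and b to y; as GL(n,2) is transitive on pairs of independent
-- vectors, this fails only for a small fraction of the quadruples (a , x , b , y) when S is nearly
-- as large as GL(n,2).  For n ≤ 8 it never fails, so φ (a , x) = x · α + a · β by algebra.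
-- Otherwise linearity testing on F₂ⁿ × F₂ⁿ yields α and β with φ (a , x) = x · α + a · β for most
-- (a , x), whence v = M α + β for most (M , v) ∈ S.  If v₀ ≠ M₀ α + β for some (M₀ , v₀) ∈ S, then
-- a positive proportion of M agree with M₀ on some row vector a with a · (v₀ + M₀ α + β) = 1
-- (by second moments), and no such M satisfies v = M α + β; so S would be too small.
module Submission where

open import Defs
open import Data.Bool using (Bool; true; false; _xor_; _∧_; not)
import Data.Bool as Bool
open import Data.Bool.Properties
  using (xor-assoc; xor-comm; xor-same; xor-identityʳ; ∧-comm; ∧-assoc; ∧-zeroʳ;
         ∧-distribʳ-xor; ∧-distribˡ-xor; T-≡; T-∧)
open import Data.Bool.Solver using (module xor-∧-Solver)
open import Data.Empty using (⊥; ⊥-elim)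
open import Data.Fin using (Fin; zero; suc)
import Data.Fin as Fin
import Data.Integer as ℤ
import Data.Integer.Properties as ℤ
open import Data.List using (List; []; _∷_; length; concatMap; _++_; cartesianProduct)
import Data.List as List
open import Data.List.Membership.Propositional using (_∈_; lose; find)
open import Data.List.Membership.Propositional.Properties using (∈-concatMap⁺; ∈-map⁺)
open import Data.List.Relation.Unary.All using (All; []; _∷_)
import Data.List.Relation.Unary.All as All
open import Data.List.Relation.Unary.AllPairs using ([]; _∷_)
open import Data.List.Relation.Unary.Any using (Any; here; there; satisfied)
import Data.List.Relation.Unary.Any as Any
open import Data.List.Relation.Unary.Any.Properties using (any⁺; any⁻)
open import Data.List.Relation.Unary.Unique.Propositional using (Unique)
open import Data.Nat using (ℕ; zero; suc; _≥_; z≤n; s≤s; NonZero; >-nonZero)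
import Data.Nat as ℕ
import Data.Nat.Properties as ℕ
open import Data.Nat.Tactic.RingSolver using (solve-∀)
open import Data.Product using (Σ; ∃; ∃₂; _×_; _,_; proj₁; proj₂)
import Data.Rational.Properties as ℚ
import Data.Rational.Unnormalised as ℚᵘ
import Data.Rational.Unnormalised.Properties as ℚᵘ
open import Data.Sum using (inj₁; inj₂)
open import Data.Vec using (Vec; []; _∷_; map; transpose; tabulate; replicate; lookup; _⊛_)
import Data.Vec as Vec
open import Data.Vec.Properties
  using (≡-dec; zipWith-comm; zipWith-assoc; map-∘; map-cong; map-id;
         tabulate∘lookup; tabulate-∘; tabulate-cong)
open import Function using (_∘_)
open import Function.Bundles using (Equivalence)
open import Relation.Binary.Definitions using (DecidableEquality)
open import Relation.Binary.PropositionalEquality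
open import Relation.Nullary using (Dec; yes; no; ¬_; ⌊_⌋; does)
open import Relation.Nullary.Decidable
  using (¬?; _×-dec_; decidable-stable; dec-true; dec-false; isYes≗does; toWitness; fromWitness)

-- A member of S sends independent pairs to independent pairs only, so the count behind φ's
-- equations covers just those (a , b) and (x , y). The linearity test runs over all of F₂ⁿ × F₂ⁿ,
-- and the dependent quadruples, a share of at most 6/2ⁿ, are simply charged as failures. From n = 9
-- on this is affordable; for smaller n an argument without error terms takes over: a failing
-- equation would make S miss a whole fibre of the action on pairs, at least |GL(n,2)|/4⁸ matrices,
-- more than its deficit allows. The budget for n ≥ 9, in units of 1/512: deficit of S at most 1;
-- failing tests at most 6 + 1 = 7, well below the 1/12 that self-correction tolerates; points where
-- φ leaves its majority at most 5 · 7 = 35; elements of S off the candidate coset at most 4 · 35 =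
-- 140; matrices sharing no relevant row with M₀ at most 320, that is 5/8. Since 140 + 320 + 1 <
-- 512, no exceptional element survives. No formula for |GL(n,2)| enters: averages over the group
-- come from fibres of equal size, the equality being witnessed by transvections, and all bounds are
-- cross-multiplied inequalities in ℕ.

private variable
  A B P P′ : Set
  m n : ℕ

module _ where
  open import Data.Nat using (_+_; _*_; _∸_; _^_; _≤_; _<_; _≟_; _≤?_)
  open import Data.Nat.Properties hiding (_≟_; _≤?_)

  -- Finite sums over lists

  ∑ : List A → (A → ℕ) → ℕ
  ∑ []       f = 0
  ∑ (x ∷ xs) f = f x + ∑ xs f

  ∑-mono-∈ : (xs : List A) {f g : A → ℕ} → (∀ {x} → x ∈ xs → f x ≤ g x) → ∑ xs f ≤ ∑ xs g
  ∑-mono-∈ []       f≤g = z≤n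
  ∑-mono-∈ (x ∷ xs) f≤g = +-mono-≤ (f≤g (here refl)) (∑-mono-∈ xs (f≤g ∘ there))

  ∑-mono : (xs : List A) {f g : A → ℕ} → (∀ x → f x ≤ g x) → ∑ xs f ≤ ∑ xs g
  ∑-mono xs f≤g = ∑-mono-∈ xs λ {x} _ → f≤g x

  ∑-cong : (xs : List A) {f g : A → ℕ} → (∀ x → f x ≡ g x) → ∑ xs f ≡ ∑ xs g
  ∑-cong []       f≡g = refl
  ∑-cong (x ∷ xs) f≡g = cong₂ _+_ (f≡g x) (∑-cong xs f≡g)

  ∑-+ : (xs : List A) (f g : A → ℕ) → ∑ xs (λ x → f x + g x) ≡ ∑ xs f + ∑ xs g
  ∑-+ []       f g = refl
  ∑-+ (x ∷ xs) f g = trans (cong (f x + g x +_) (∑-+ xs f g))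
    (interchange (f x) (g x) (∑ xs f) (∑ xs g))
    where
    interchange : ∀ a b c d → a + b + (c + d) ≡ a + c + (b + d)
    interchange = solve-∀

  ∑-*ˡ : (xs : List A) (c : ℕ) (f : A → ℕ) → ∑ xs (λ x → c * f x) ≡ c * ∑ xs f
  ∑-*ˡ []       c f = sym (*-zeroʳ c)
  ∑-*ˡ (x ∷ xs) c f = trans (cong (c * f x +_) (∑-*ˡ xs c f)) (sym (*-distribˡ-+ c (f x) (∑ xs f)))

  ∑-*ʳ : (xs : List A) (c : ℕ) (f : A → ℕ) → ∑ xs (λ x → f x * c) ≡ ∑ xs f * c
  ∑-*ʳ xs c f = trans (∑-cong xs λ x → *-comm (f x) c) (trans (∑-*ˡ xs c f) (*-comm c (∑ xs f)))

  ∑-0 : (xs : List A) → ∑ xs (λ _ → 0) ≡ 0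
  ∑-0 []       = refl
  ∑-0 (x ∷ xs) = ∑-0 xs

  ∑-length : (xs : List A) → ∑ xs (λ _ → 1) ≡ length xs
  ∑-length []       = refl
  ∑-length (x ∷ xs) = cong suc (∑-length xs)

  ∑-swap : (xs : List A) (ys : List B) (f : A → B → ℕ) →
           ∑ xs (λ x → ∑ ys (f x)) ≡ ∑ ys (λ y → ∑ xs (λ x → f x y))
  ∑-swap []       ys f = sym (∑-0 ys)
  ∑-swap (x ∷ xs) ys f = trans (cong (∑ ys (f x) +_) (∑-swap xs ys f))
    (sym (∑-+ ys (f x) (λ y → ∑ xs (λ x′ → f x′ y))))

  ∑-product : (xs : List A) (ys : List B) (f : A → ℕ) (g : B → ℕ) →
              ∑ xs (λ x → ∑ ys (λ y → f x * g y)) ≡ ∑ xs f * ∑ ys g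
  ∑-product xs ys f g = trans (∑-cong xs λ x → ∑-*ˡ ys (f x) g) (∑-*ʳ xs (∑ ys g) f)

  ∑-map : (xs : List A) (h : A → B) (f : B → ℕ) → ∑ (List.map h xs) f ≡ ∑ xs (f ∘ h)
  ∑-map []       h f = refl
  ∑-map (x ∷ xs) h f = cong (f (h x) +_) (∑-map xs h f)

  ∑-++ : (xs ys : List A) (f : A → ℕ) → ∑ (xs ++ ys) f ≡ ∑ xs f + ∑ ys f
  ∑-++ []       ys f = refl
  ∑-++ (x ∷ xs) ys f = trans (cong (f x +_) (∑-++ xs ys f)) (sym (+-assoc (f x) _ _))

  ∑-concatMap : (xs : List A) (h : A → List B) (f : B → ℕ) →
                ∑ (concatMap h xs) f ≡ ∑ xs (λ x → ∑ (h x) f)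
  ∑-concatMap []       h f = refl
  ∑-concatMap (x ∷ xs) h f = trans (∑-++ (h x) _ f) (cong (∑ (h x) f +_) (∑-concatMap xs h f))

  ∑-single : (xs : List A) (f : A → ℕ) {x : A} → x ∈ xs → f x ≤ ∑ xs f
  ∑-single (x ∷ xs) f (here refl) = m≤m+n (f x) _
  ∑-single (x ∷ xs) f (there x∈) = ≤-trans (∑-single xs f x∈) (m≤n+m _ (f x))

  -- Indicators and counting by enumeration

  𝟙 : Dec P → ℕ
  𝟙 (yes _) = 1
  𝟙 (no _)  = 0

  𝟙-yes : (d : Dec P) → P → 𝟙 d ≡ 1
  𝟙-yes (yes _) p = refl
  𝟙-yes (no ¬p) p = ⊥-elim (¬p p)

  𝟙-no : (d : Dec P) → ¬ P → 𝟙 d ≡ 0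
  𝟙-no (yes p) ¬p = ⊥-elim (¬p p)
  𝟙-no (no _)  ¬p = refl

  𝟙-mono : (d : Dec P) (e : Dec P′) → (P → P′) → 𝟙 d ≤ 𝟙 e
  𝟙-mono (yes p) e i = ≤-reflexive (sym (𝟙-yes e (i p)))
  𝟙-mono (no _)  e i = z≤n

  𝟙-cong : (d : Dec P) (e : Dec P′) → (P → P′) → (P′ → P) → 𝟙 d ≡ 𝟙 e
  𝟙-cong d e i j = ≤-antisym (𝟙-mono d e i) (𝟙-mono e d j)

  𝟙≤1 : (d : Dec P) → 𝟙 d ≤ 1
  𝟙≤1 (yes _) = ≤-refl
  𝟙≤1 (no _)  = z≤n

  -- Every element of A occurs exactly once in xs.
  Enumerates : DecidableEquality A → List A → Set
  Enumerates {A} _≟_ xs = ∀ (y : A) (f : A → ℕ) → ∑ xs (λ x → 𝟙 (x ≟ y) * f x) ≡ f y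

  ∑-vecsOver : (xs : List A) (m : ℕ) (f : Vec A (suc m) → ℕ) →
               ∑ (vecsOver xs (suc m)) f ≡ ∑ xs (λ x → ∑ (vecsOver xs m) (λ v → f (x ∷ v)))
  ∑-vecsOver xs m f = trans (∑-concatMap xs _ f) (∑-cong xs λ x → ∑-map (vecsOver xs m) (x ∷_) f)

  -- Applied with row vectors as entries: a map that permutes the rows also permutes the matrices
  -- when it acts on every row.
  ∑-vecsOver-map : (xs : List A) (t : A → A) → (∀ f → ∑ xs (f ∘ t) ≡ ∑ xs f) →
                   ∀ m f → ∑ (vecsOver xs m) (f ∘ Vec.map t) ≡ ∑ (vecsOver xs m) f
  ∑-vecsOver-map xs t inv zero    f = refl
  ∑-vecsOver-map xs t inv (suc m) f = begin
    ∑ (vecsOver xs (suc m)) (f ∘ Vec.map t)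
      ≡⟨ ∑-vecsOver xs m _ ⟩
    ∑ xs (λ x → ∑ (vecsOver xs m) (λ v → f (t x ∷ Vec.map t v)))
      ≡⟨ ∑-cong xs (λ x → ∑-vecsOver-map xs t inv m (λ v → f (t x ∷ v))) ⟩
    ∑ xs (λ x → ∑ (vecsOver xs m) (λ v → f (t x ∷ v)))
      ≡⟨ inv (λ x → ∑ (vecsOver xs m) (λ v → f (x ∷ v))) ⟩
    ∑ xs (λ x → ∑ (vecsOver xs m) (λ v → f (x ∷ v)))
      ≡⟨ sym (∑-vecsOver xs m f) ⟩
    ∑ (vecsOver xs (suc m)) f ∎
    where open ≡-Reasoning

  ∑-vecsOver-1 : (xs : List A) (m : ℕ) → ∑ (vecsOver xs m) (λ _ → 1) ≡ length xs ^ m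
  ∑-vecsOver-1 xs zero    = refl
  ∑-vecsOver-1 xs (suc m) = begin
    ∑ (vecsOver xs (suc m)) (λ _ → 1)             ≡⟨ ∑-vecsOver xs m _ ⟩
    ∑ xs (λ _ → ∑ (vecsOver xs m) (λ _ → 1))      ≡⟨ ∑-cong xs (λ _ → trans (∑-vecsOver-1 xs m) (sym (*-identityˡ _))) ⟩
    ∑ xs (λ _ → 1 * length xs ^ m)                ≡⟨ ∑-*ʳ xs (length xs ^ m) (λ _ → 1) ⟩
    ∑ xs (λ _ → 1) * length xs ^ m                ≡⟨ cong (_* length xs ^ m) (∑-length xs) ⟩
    length xs * length xs ^ m ∎
    where open ≡-Reasoning

  vecsOver-enumerates : (_≟_ : DecidableEquality A) (xs : List A) → Enumerates _≟_ xs →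
                        ∀ m → Enumerates (≡-dec {n = m} _≟_) (vecsOver xs m)
  vecsOver-enumerates _≟_ xs enum zero    []      f = trans (+-identityʳ _) (+-identityʳ _)
  vecsOver-enumerates _≟_ xs enum (suc m) (y ∷ w) f = begin
    ∑ (vecsOver xs (suc m)) (λ v → 𝟙 (≡-dec _≟_ v (y ∷ w)) * f v)
      ≡⟨ ∑-vecsOver xs m _ ⟩
    ∑ xs (λ x → ∑ (vecsOver xs m) (λ v → 𝟙 (≡-dec _≟_ (x ∷ v) (y ∷ w)) * f (x ∷ v)))
      ≡⟨ ∑-cong xs (λ x → trans (∑-cong (vecsOver xs m) (factor x)) (∑-*ˡ (vecsOver xs m) (𝟙 (x ≟ y)) _)) ⟩
    ∑ xs (λ x → 𝟙 (x ≟ y) * ∑ (vecsOver xs m) (λ v → 𝟙 (≡-dec _≟_ v w) * f (x ∷ v)))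
      ≡⟨ enum y _ ⟩
    ∑ (vecsOver xs m) (λ v → 𝟙 (≡-dec _≟_ v w) * f (y ∷ v))
      ≡⟨ vecsOver-enumerates _≟_ xs enum m w (λ v → f (y ∷ v)) ⟩
    f (y ∷ w) ∎
    where
    open ≡-Reasoning
    factor : ∀ x v → 𝟙 (≡-dec _≟_ (x ∷ v) (y ∷ w)) * f (x ∷ v) ≡
                     𝟙 (x ≟ y) * (𝟙 (≡-dec _≟_ v w) * f (x ∷ v))
    factor x v = trans (cong (_* f (x ∷ v)) (split (x ≟ y) (≡-dec _≟_ v w) (≡-dec _≟_ (x ∷ v) (y ∷ w))))
                       (*-assoc (𝟙 (x ≟ y)) _ _)
      where
      split : (d : Dec (x ≡ y)) (e : Dec (v ≡ w)) (c : Dec (x ∷ v ≡ y ∷ w)) → 𝟙 c ≡ 𝟙 d * 𝟙 e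
      split (yes refl) (yes refl) c = 𝟙-yes c refl
      split (yes refl) (no v≢w)   c = 𝟙-no c λ { refl → v≢w refl }
      split (no x≢y)   e          c = 𝟙-no c λ { refl → x≢y refl }

  -- The union bound, with the covering condition in contrapositive form: the events below are
  -- disagreements of Booleans, and what one derives from their absence is an equation.
  𝟙-cover₂ : ∀ {P P₁ P₂ : Set} (d : Dec P) (d₁ : Dec P₁) (d₂ : Dec P₂) →
             (¬ P₁ → ¬ P₂ → ¬ P) → 𝟙 d ≤ 𝟙 d₁ + 𝟙 d₂
  𝟙-cover₂ d (yes _)  d₂       c = ≤-trans (𝟙≤1 d) (m≤m+n 1 _)
  𝟙-cover₂ d (no ¬p₁) (yes _)  c = 𝟙≤1 d
  𝟙-cover₂ d (no ¬p₁) (no ¬p₂) c = ≤-reflexive (𝟙-no d (c ¬p₁ ¬p₂))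

  -- Xor identities and the linearity test

  true≢false : true ≢ false
  true≢false ()

  _≢?_ : (a b : Bool) → Dec (a ≢ b)
  a ≢? b = ¬? (a Bool.≟ b)

  ≢?-stable : ∀ {a b : Bool} → ¬ (a ≢ b) → a ≡ b
  ≢?-stable {a} {b} = decidable-stable (a Bool.≟ b)

  xor-cancel-middle : ∀ a b c → (a xor b) xor (b xor c) ≡ a xor c
  xor-cancel-middle a b c = begin
    (a xor b) xor (b xor c)  ≡⟨ xor-assoc a b _ ⟩
    a xor (b xor (b xor c))  ≡⟨ cong (a xor_) (sym (xor-assoc b b c)) ⟩
    a xor ((b xor b) xor c)  ≡⟨ cong (λ z → a xor (z xor c)) (xor-same b) ⟩
    a xor c                  ∎
    where open ≡-Reasoning

  xor-cancelʳ : ∀ a b → (a xor b) xor b ≡ a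
  xor-cancelʳ a b = trans (xor-assoc a b b) (trans (cong (a xor_) (xor-same b)) (xor-identityʳ a))

  xor-exchange : ∀ a b c d → a xor c ≡ b xor d → a xor d ≡ b xor c
  xor-exchange a b c d eq = begin
    a xor d                  ≡⟨ sym (xor-cancel-middle a c d) ⟩
    (a xor c) xor (c xor d)  ≡⟨ cong₂ _xor_ eq (xor-comm c d) ⟩
    (b xor d) xor (d xor c)  ≡⟨ xor-cancel-middle b d c ⟩
    b xor c                  ∎
    where open ≡-Reasoning

  -- The Blum–Luby–Rubinfeld linearity test, by self-correction: the majority vote of
  -- φ (p ⊕ q) − φ q over q is additive as soon as φ passes most tests.
  module LinearityTest
    {G : Set} (_⊕_ : G → G → G) (gs : List G)
    (∑-translate : ∀ p (f : G → ℕ) → ∑ gs (λ q → f (p ⊕ q)) ≡ ∑ gs f)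
    (⊕-comm : ∀ p q → p ⊕ q ≡ q ⊕ p)
    (⊕-assoc : ∀ p q r → (p ⊕ q) ⊕ r ≡ p ⊕ (q ⊕ r))
    (φ : G → Bool)
    where

    order : ℕ
    order = ∑ gs λ _ → 1

    fails? : (p q : G) → Dec (φ (p ⊕ q) ≢ φ p xor φ q)
    fails? p q = φ (p ⊕ q) ≢? (φ p xor φ q)

    defect : ℕ
    defect = ∑ gs λ p → ∑ gs λ q → 𝟙 (fails? p q)

    vote : G → G → Bool
    vote p q = φ (p ⊕ q) xor φ q

    count : G → Bool → ℕ
    count p b = ∑ gs λ q → 𝟙 (vote p q Bool.≟ b)

    winner : ∀ p → Σ Bool λ b → count p (not b) ≤ count p b
    winner p with ≤-total (count p false) (count p true)
    ... | inj₁ le = true , le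
    ... | inj₂ ge = false , ge

    majority : G → Bool
    majority p = proj₁ (winner p)

    dissent : G → ℕ
    dissent p = ∑ gs λ q → 𝟙 (vote p q ≢? majority p)

    count-total : ∀ p → count p true + count p false ≡ order
    count-total p = trans (sym (∑-+ gs _ _)) (∑-cong gs λ q → either (vote p q))
      where
      either : ∀ b → 𝟙 (b Bool.≟ true) + 𝟙 (b Bool.≟ false) ≡ 1
      either true  = refl
      either false = refl

    -- The point p ⊕ q ⊕ r splits both as (p ⊕ q) ⊕ r and as (p ⊕ r) ⊕ q. If both tests pass, q and
    -- r cast the same vote for p; so each pair of opposite votes is paid for by a failing test, and
    -- by translation invariance either kind of test runs over all tests once.
    count-product : ∀ p → count p true * count p false ≤ 2 * defect
    count-product p = begin
      count p true * count p false
        ≡⟨ sym (∑-product gs gs _ _) ⟩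
      ∑ gs (λ q → ∑ gs λ r → 𝟙 (vote p q Bool.≟ true) * 𝟙 (vote p r Bool.≟ false))
        ≤⟨ ∑-mono gs (λ q → ∑-mono gs (collide q)) ⟩
      ∑ gs (λ q → ∑ gs λ r → 𝟙 (fails? (p ⊕ q) r) + 𝟙 (fails? (p ⊕ r) q))
        ≡⟨ trans (∑-cong gs λ q → ∑-+ gs _ _) (∑-+ gs _ _) ⟩
      ∑ gs (λ q → ∑ gs λ r → 𝟙 (fails? (p ⊕ q) r)) + ∑ gs (λ q → ∑ gs λ r → 𝟙 (fails? (p ⊕ r) q))
        ≡⟨ cong₂ _+_ (∑-translate p _) (trans (∑-swap gs gs _) (∑-translate p _)) ⟩
      defect + defect
        ≡⟨ cong (defect +_) (sym (+-identityʳ defect)) ⟩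
      2 * defect ∎
      where
      open ≤-Reasoning
      regroup : ∀ q r → (p ⊕ q) ⊕ r ≡ (p ⊕ r) ⊕ q
      regroup q r = trans (⊕-assoc p q r) (trans (cong (p ⊕_) (⊕-comm q r)) (sym (⊕-assoc p r q)))
      agree : ∀ q r → ¬ (φ ((p ⊕ q) ⊕ r) ≢ φ (p ⊕ q) xor φ r) →
              ¬ (φ ((p ⊕ r) ⊕ q) ≢ φ (p ⊕ r) xor φ q) → vote p q ≡ vote p r
      agree q r h₁ h₂ = xor-exchange (φ (p ⊕ q)) (φ (p ⊕ r)) (φ r) (φ q)
        (trans (sym (≢?-stable h₁)) (trans (cong φ (regroup q r)) (≢?-stable h₂)))
      collide : ∀ q r → 𝟙 (vote p q Bool.≟ true) * 𝟙 (vote p r Bool.≟ false) ≤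
                        𝟙 (fails? (p ⊕ q) r) + 𝟙 (fails? (p ⊕ r) q)
      collide q r = ≤-trans (differ (vote p q) (vote p r))
        (𝟙-cover₂ (vote p q ≢? vote p r) (fails? (p ⊕ q) r) (fails? (p ⊕ r) q) λ h₁ h₂ ne → ne (agree q r h₁ h₂))
        where
        differ : ∀ a b → 𝟙 (a Bool.≟ true) * 𝟙 (b Bool.≟ false) ≤ 𝟙 (a ≢? b)
        differ true  true  = z≤n
        differ true  false = ≤-refl
        differ false b     = z≤n

    count-complement : ∀ p b → count p b + count p (not b) ≡ order
    count-complement p true  = count-total p
    count-complement p false = trans (+-comm (count p false) _) (count-total p)

    count-product′ : ∀ p b → count p b * count p (not b) ≤ 2 * defect
    count-product′ p true  = count-product p
    count-product′ p false = ≤-trans (≤-reflexive (*-comm (count p false) _)) (count-product p)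

    -- The winning side holds at least half of the votes, so `order` is at most twice its count;
    -- multiplied by the losing count this is twice the product bounded above.
    dissent-bound : ∀ p → order * dissent p ≤ 4 * defect
    dissent-bound p = begin
      order * dissent p
        ≡⟨ cong₂ _*_ (sym (count-complement p b)) (∑-cong gs λ q → ≢⇔≡not (vote p q) b) ⟩
      (count p b + count p (not b)) * count p (not b)
        ≤⟨ *-monoˡ-≤ (count p (not b)) (+-monoʳ-≤ (count p b) (proj₂ (winner p))) ⟩
      (count p b + count p b) * count p (not b)
        ≡⟨ double (count p b) (count p (not b)) ⟩
      2 * (count p b * count p (not b))
        ≤⟨ *-monoʳ-≤ 2 (count-product′ p b) ⟩
      2 * (2 * defect)
        ≡⟨ sym (*-assoc 2 2 defect) ⟩
      4 * defect ∎
      where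
      open ≤-Reasoning
      b : Bool
      b = majority p
      double : ∀ c d → (c + c) * d ≡ 2 * (c * d)
      double = solve-∀
      ≢⇔≡not : ∀ a b → 𝟙 (a ≢? b) ≡ 𝟙 (a Bool.≟ not b)
      ≢⇔≡not true  true  = refl
      ≢⇔≡not true  false = refl
      ≢⇔≡not false true  = refl
      ≢⇔≡not false false = refl

    -- If additivity failed at p and p′, then every q would dissent in at least one of three votes,
    -- for p, p′ or p ⊕ p′. Three dissents of at most 4 `defect` / `order` each cannot exhaust
    -- `order`; hence the 12.
    majority-additive : 12 * defect < order * order →
                        ∀ p p′ → majority (p ⊕ p′) ≡ majority p xor majority p′
    majority-additive small p p′ with majority (p ⊕ p′) Bool.≟ (majority p xor majority p′)
    ... | yes eq = eq
    ... | no ne  = ⊥-elim (<⇒≱ small (begin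
      order * order
        ≤⟨ *-monoʳ-≤ order everyone ⟩
      order * (dissent p + (dissent p′ + dissent (p ⊕ p′)))
        ≡⟨ trans (*-distribˡ-+ order (dissent p) _)
                 (cong (order * dissent p +_) (*-distribˡ-+ order (dissent p′) _)) ⟩
      order * dissent p + (order * dissent p′ + order * dissent (p ⊕ p′))
        ≤⟨ +-mono-≤ (dissent-bound p) (+-mono-≤ (dissent-bound p′) (dissent-bound (p ⊕ p′))) ⟩
      4 * defect + (4 * defect + 4 * defect)
        ≡⟨ collect defect ⟩
      12 * defect ∎))
      where
      open ≤-Reasoning
      collect : ∀ d → 4 * d + (4 * d + 4 * d) ≡ 12 * d
      collect = solve-∀
      -- The vote for p′ is taken at p ⊕ q rather than at q, so that φ (p ⊕ q) cancels; summing over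
      -- q, translation undoes the shift.
      consistent : ∀ q → vote p′ (p ⊕ q) xor vote p q ≡ vote (p ⊕ p′) q
      consistent q = trans (xor-cancel-middle (φ (p′ ⊕ (p ⊕ q))) (φ (p ⊕ q)) (φ q))
        (cong (λ z → φ z xor φ q) (trans (sym (⊕-assoc p′ p q)) (cong (_⊕ q) (⊕-comm p′ p))))
      dissenter : ∀ q → 1 ≤ 𝟙 (vote p q ≢? majority p) +
        (𝟙 (vote p′ (p ⊕ q) ≢? majority p′) + 𝟙 (vote (p ⊕ p′) q ≢? majority (p ⊕ p′)))
      dissenter q with vote p q ≢? majority p | vote p′ (p ⊕ q) ≢? majority p′
                     | vote (p ⊕ p′) q ≢? majority (p ⊕ p′)
      ... | yes _ | _     | _     = s≤s z≤n
      ... | no _  | yes _ | _     = s≤s z≤n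
      ... | no _  | no _  | yes _ = s≤s z≤n
      ... | no h₁ | no h₂ | no h₃ = ⊥-elim (ne (trans (sym (≢?-stable h₃))
        (trans (sym (consistent q))
               (trans (cong₂ _xor_ (≢?-stable h₂) (≢?-stable h₁)) (xor-comm (majority p′) _)))))
      everyone : order ≤ dissent p + (dissent p′ + dissent (p ⊕ p′))
      everyone = begin
        order
          ≤⟨ ∑-mono gs dissenter ⟩
        ∑ gs (λ q → 𝟙 (vote p q ≢? majority p) + (𝟙 (vote p′ (p ⊕ q) ≢? majority p′)
                    + 𝟙 (vote (p ⊕ p′) q ≢? majority (p ⊕ p′))))
          ≡⟨ trans (∑-+ gs _ _) (cong (dissent p +_) (∑-+ gs _ _)) ⟩
        dissent p + (∑ gs (λ q → 𝟙 (vote p′ (p ⊕ q) ≢? majority p′)) + dissent (p ⊕ p′))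
          ≡⟨ cong (λ z → dissent p + (z + dissent (p ⊕ p′)))
                  (∑-translate p λ q → 𝟙 (vote p′ q ≢? majority p′)) ⟩
        dissent p + (dissent p′ + dissent (p ⊕ p′)) ∎

    distance : ℕ
    distance = ∑ gs λ p → 𝟙 (φ p ≢? majority p)

    -- Where φ p differs from the majority, every q either dissents at p or fails the test with p.
    -- This gives 4 + 1 defects; the extra factor `order`, cancelled at the start, is there because
    -- `dissent-bound` only controls `order * dissent p`.
    majority-close : 0 < order → order * distance ≤ 5 * defect
    majority-close pos = *-cancelˡ-≤ order {{>-nonZero pos}} (begin
      order * (order * distance)
        ≤⟨ *-monoʳ-≤ order (begin
          order * distance
            ≡⟨ trans (*-comm order distance) (sym (∑-product gs gs _ λ _ → 1)) ⟩
          ∑ gs (λ p → ∑ gs λ q → 𝟙 (φ p ≢? majority p) * 1)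
            ≤⟨ ∑-mono gs (λ p → ∑-mono gs λ q → ≤-trans (≤-reflexive (*-identityʳ _)) (detect p q)) ⟩
          ∑ gs (λ p → ∑ gs λ q → 𝟙 (vote p q ≢? majority p) + 𝟙 (fails? p q))
            ≡⟨ trans (∑-cong gs λ p → ∑-+ gs _ _) (∑-+ gs _ _) ⟩
          ∑ gs dissent + defect ∎) ⟩
      order * (∑ gs dissent + defect)
        ≡⟨ *-distribˡ-+ order _ defect ⟩
      order * ∑ gs dissent + order * defect
        ≡⟨ cong (_+ order * defect) (sym (∑-*ˡ gs order dissent)) ⟩
      ∑ gs (λ p → order * dissent p) + order * defect
        ≤⟨ +-monoˡ-≤ (order * defect) (∑-mono gs λ p →
             ≤-trans (dissent-bound p) (≤-reflexive (sym (*-identityˡ (4 * defect))))) ⟩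
      ∑ gs (λ _ → 1 * (4 * defect)) + order * defect
        ≡⟨ cong (_+ order * defect) (∑-*ʳ gs (4 * defect) λ _ → 1) ⟩
      order * (4 * defect) + order * defect
        ≡⟨ collect order defect ⟩
      order * (5 * defect) ∎)
      where
      open ≤-Reasoning
      collect : ∀ q d → q * (4 * d) + q * d ≡ q * (5 * d)
      collect = solve-∀
      detect : ∀ p q → 𝟙 (φ p ≢? majority p) ≤ 𝟙 (vote p q ≢? majority p) + 𝟙 (fails? p q)
      detect p q = 𝟙-cover₂ (φ p ≢? majority p) (vote p q ≢? majority p) (fails? p q) λ h₁ h₂ ne → ne
        (trans (sym (xor-cancelʳ (φ p) (φ q)))
               (trans (cong (_xor φ q) (sym (≢?-stable h₂))) (≢?-stable h₁)))

  -- The vector space F₂ⁿ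

  infix 4 _≟ᵥ_

  _≟ᵥ_ : DecidableEquality (Vect n)
  _≟ᵥ_ = ≡-dec Bool._≟_

  V : ∀ n → List (Vect n)
  V n = vecsOver (true ∷ false ∷ []) n

  +ᵥ-comm : (u v : Vect n) → u +ᵥ v ≡ v +ᵥ u
  +ᵥ-comm = zipWith-comm xor-comm

  +ᵥ-assoc : (u v w : Vect n) → (u +ᵥ v) +ᵥ w ≡ u +ᵥ (v +ᵥ w)
  +ᵥ-assoc = zipWith-assoc xor-assoc

  +ᵥ-identityˡ : (v : Vect n) → zeroVec n +ᵥ v ≡ v
  +ᵥ-identityˡ []      = refl
  +ᵥ-identityˡ (b ∷ v) = cong (b ∷_) (+ᵥ-identityˡ v)

  +ᵥ-identityʳ : (v : Vect n) → v +ᵥ zeroVec n ≡ v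
  +ᵥ-identityʳ v = trans (+ᵥ-comm v _) (+ᵥ-identityˡ v)

  +ᵥ-same : (v : Vect n) → v +ᵥ v ≡ zeroVec n
  +ᵥ-same []      = refl
  +ᵥ-same (b ∷ v) = cong₂ _∷_ (xor-same b) (+ᵥ-same v)

  +ᵥ-cancelˡ : (u v : Vect n) → u +ᵥ (u +ᵥ v) ≡ v
  +ᵥ-cancelˡ u v = trans (sym (+ᵥ-assoc u u v)) (trans (cong (_+ᵥ v) (+ᵥ-same u)) (+ᵥ-identityˡ v))

  +ᵥ≡0⇒≡ : (u v : Vect n) → u +ᵥ v ≡ zeroVec n → u ≡ v
  +ᵥ≡0⇒≡ u v eq = sym (trans (sym (+ᵥ-cancelˡ u v)) (trans (cong (u +ᵥ_) eq) (+ᵥ-identityʳ u)))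

  dot-comm : (u v : Vect n) → dot u v ≡ dot v u
  dot-comm []      []      = refl
  dot-comm (a ∷ u) (b ∷ v) = cong₂ _xor_ (∧-comm a b) (dot-comm u v)

  xor-interchange : ∀ a b c d → (a xor b) xor (c xor d) ≡ (a xor c) xor (b xor d)
  xor-interchange a b c d = begin
    (a xor b) xor (c xor d)  ≡⟨ xor-assoc a b _ ⟩
    a xor (b xor (c xor d))  ≡⟨ cong (a xor_) (sym (xor-assoc b c d)) ⟩
    a xor ((b xor c) xor d)  ≡⟨ cong (λ z → a xor (z xor d)) (xor-comm b c) ⟩
    a xor ((c xor b) xor d)  ≡⟨ cong (a xor_) (xor-assoc c b d) ⟩
    a xor (c xor (b xor d))  ≡⟨ sym (xor-assoc a c _) ⟩
    (a xor c) xor (b xor d)  ∎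
    where open ≡-Reasoning

  dot-+ˡ : (u v w : Vect n) → dot (u +ᵥ v) w ≡ dot u w xor dot v w
  dot-+ˡ []      []      []      = refl
  dot-+ˡ (a ∷ u) (b ∷ v) (c ∷ w) = trans (cong₂ _xor_ (∧-distribʳ-xor c a b) (dot-+ˡ u v w))
    (xor-interchange (a ∧ c) (b ∧ c) (dot u w) (dot v w))

  dot-+ʳ : (w u v : Vect n) → dot w (u +ᵥ v) ≡ dot w u xor dot w v
  dot-+ʳ w u v = trans (dot-comm w _) (trans (dot-+ˡ u v w) (cong₂ _xor_ (dot-comm u w) (dot-comm v w)))

  dot-zeroˡ : (w : Vect n) → dot (zeroVec n) w ≡ false
  dot-zeroˡ []      = refl
  dot-zeroˡ (b ∷ w) = dot-zeroˡ w

  dot-zeroʳ : (w : Vect n) → dot w (zeroVec n) ≡ false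
  dot-zeroʳ w = trans (dot-comm w _) (dot-zeroˡ w)

  dot≡true⇒≢0 : (u w : Vect n) → dot u w ≡ true → u ≢ zeroVec n
  dot≡true⇒≢0 u w eq refl = true≢false (trans (sym eq) (dot-zeroˡ w))

  nonzero-witness : (u : Vect n) → u ≢ zeroVec n → ∃ λ w → dot u w ≡ true
  nonzero-witness []          u≢0 = ⊥-elim (u≢0 refl)
  nonzero-witness (true  ∷ u) u≢0 = true ∷ zeroVec _ , cong not (dot-zeroʳ u)
  nonzero-witness (false ∷ u) u≢0 with nonzero-witness u (u≢0 ∘ cong (false ∷_))
  ... | w , eq = false ∷ w , eq

  -- Nondegeneracy of the pairing. Many later identities between vectors are proved by pairing with
  -- an arbitrary w, which turns linear algebra into Boolean algebra.
  dot-ext : {u v : Vect n} → (∀ w → dot u w ≡ dot v w) → u ≡ v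
  dot-ext {u = u} {v} eq with u ≟ᵥ v
  ... | yes u≡v = u≡v
  ... | no u≢v with nonzero-witness (u +ᵥ v) (u≢v ∘ +ᵥ≡0⇒≡ u v)
  ...   | w , ne = ⊥-elim (true≢false
    (trans (sym ne) (trans (dot-+ˡ u v w) (trans (cong (_xor dot v w) (eq w)) (xor-same (dot v w))))))

  -- Additivity splits off the first coordinate; its coefficient is the value of χ at the first
  -- basis vector.
  additive⇒dot : (χ : Vect n → Bool) → (∀ x y → χ (x +ᵥ y) ≡ χ x xor χ y) → ∃ λ α → ∀ x → χ x ≡ dot x α
  additive⇒dot {zero}  χ add = [] , λ { [] → trans (add [] []) (xor-same (χ [])) }
  additive⇒dot {suc n} χ add with additive⇒dot (λ x → χ (false ∷ x)) (λ x y → add (false ∷ x) (false ∷ y))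
  ... | α , χ≡ = χ (true ∷ zeroVec n) ∷ α , λ
    { (false ∷ x) → χ≡ x
    ; (true  ∷ x) → trans (cong (λ y → χ (true ∷ y)) (sym (+ᵥ-identityˡ x)))
                     (trans (add (true ∷ zeroVec n) (false ∷ x)) (cong (χ (true ∷ zeroVec n) xor_) (χ≡ x))) }

  scale : Bool → Vect n → Vect n
  scale b = map (b ∧_)

  dot-scale : ∀ b (v w : Vect n) → dot (scale b v) w ≡ b ∧ dot v w
  dot-scale b []      []      = sym (∧-zeroʳ b)
  dot-scale b (c ∷ v) (d ∷ w) = trans (cong₂ _xor_ (∧-assoc b c d) (dot-scale b v w))
    (sym (∧-distribˡ-xor b (c ∧ d) (dot v w)))

  -- Sums over F₂ⁿ

  bools-enumerates : Enumerates Bool._≟_ (true ∷ false ∷ [])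
  bools-enumerates true  f = trans (+-identityʳ _) (+-identityʳ _)
  bools-enumerates false f = trans (+-identityʳ _) (+-identityʳ _)

  V-enumerates : ∀ n → Enumerates _≟ᵥ_ (V n)
  V-enumerates = vecsOver-enumerates Bool._≟_ (true ∷ false ∷ []) bools-enumerates

  ∑V-translate : (v : Vect n) (f : Vect n → ℕ) → ∑ (V n) (λ x → f (v +ᵥ x)) ≡ ∑ (V n) f
  ∑V-translate                 []      f = refl
  ∑V-translate {n = suc n} (b ∷ v) f = begin
    ∑ (V (suc n)) (λ x → f ((b ∷ v) +ᵥ x))
      ≡⟨ ∑-vecsOver bools n _ ⟩
    ∑ bools (λ c → ∑ (V n) λ x → f ((b xor c) ∷ (v +ᵥ x)))
      ≡⟨ ∑-cong bools (λ c → ∑V-translate v (λ x → f ((b xor c) ∷ x))) ⟩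
    ∑ bools (λ c → ∑ (V n) λ x → f ((b xor c) ∷ x))
      ≡⟨ flip b (λ c → ∑ (V n) λ x → f (c ∷ x)) ⟩
    ∑ bools (λ c → ∑ (V n) λ x → f (c ∷ x))
      ≡⟨ sym (∑-vecsOver bools n f) ⟩
    ∑ (V (suc n)) f ∎
    where
    open ≡-Reasoning
    bools = true ∷ false ∷ []
    flip : ∀ b (g : Bool → ℕ) → ∑ bools (λ c → g (b xor c)) ≡ ∑ bools g
    flip false g = refl
    flip true  g = trans (cong (g false +_) (+-identityʳ _))
      (trans (+-comm (g false) _) (cong (g true +_) (sym (+-identityʳ _))))

  ∑V-1 : ∀ n → ∑ (V n) (λ _ → 1) ≡ 2 ^ n
  ∑V-1 = ∑-vecsOver-1 _

  -- Translation by a vector u with u · w = 1 exchanges the two level sets of a ↦ a · w.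
  ∑V-halfspace : (w : Vect n) → w ≢ zeroVec n → 2 * ∑ (V n) (λ a → 𝟙 (dot a w Bool.≟ true)) ≡ 2 ^ n
  ∑V-halfspace {n} w w≢0 with nonzero-witness w w≢0
  ... | u , dot≡true = begin
    2 * H
      ≡⟨ cong (H +_) (+-identityʳ H) ⟩
    H + H
      ≡⟨ cong (H +_) (sym (∑V-translate u _)) ⟩
    H + ∑ (V n) (λ a → 𝟙 (dot (u +ᵥ a) w Bool.≟ true))
      ≡⟨ sym (∑-+ (V n) _ _) ⟩
    ∑ (V n) (λ a → 𝟙 (dot a w Bool.≟ true) + 𝟙 (dot (u +ᵥ a) w Bool.≟ true))
      ≡⟨ ∑-cong (V n) (λ a → trans (cong (λ b → 𝟙 (dot a w Bool.≟ true) + 𝟙 (b Bool.≟ true)) (flipped a)) (one (dot a w))) ⟩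
    ∑ (V n) (λ _ → 1)
      ≡⟨ ∑V-1 n ⟩
    2 ^ n ∎
    where
    open ≡-Reasoning
    H = ∑ (V n) (λ a → 𝟙 (dot a w Bool.≟ true))
    flipped : ∀ a → dot (u +ᵥ a) w ≡ not (dot a w)
    flipped a = trans (dot-+ˡ u a w) (cong (_xor dot a w) (trans (dot-comm u w) dot≡true))
    one : ∀ b → 𝟙 (b Bool.≟ true) + 𝟙 (not b Bool.≟ true) ≡ 1
    one true  = refl
    one false = refl

  ∑V-single : (y : Vect n) → ∑ (V n) (λ x → 𝟙 (x ≟ᵥ y)) ≡ 1
  ∑V-single {n} y = trans (∑-cong (V n) λ x → sym (*-identityʳ _)) (V-enumerates n y (λ _ → 1))

  -- Transvections

  -- For v · u = 0 this is an involution. Such maps are the only group elements needed to obtain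
  -- transitivity of GL(n,2) on nonzero vectors and on independent pairs.
  transvection : (u v : Vect n) → Vect n → Vect n
  transvection u v x = x +ᵥ scale (dot x u) v

  -- Two nonzero functionals take the value 1 simultaneously, since F₂ⁿ is not the
  -- union of two proper subspaces.
  separate₂ : (x y : Vect n) → x ≢ zeroVec n → y ≢ zeroVec n → ∃ λ u → dot x u ≡ true × dot y u ≡ true
  separate₂ x y x≢0 y≢0 with nonzero-witness x x≢0 | nonzero-witness y y≢0
  ... | u , xu | w , yw with dot y u in yu | dot x w in xw
  ...   | true  | _     = u , xu , yu
  ...   | false | true  = w , xw , yw
  ...   | false | false = u +ᵥ w , trans (dot-+ʳ x u w) (cong₂ _xor_ xu xw)
                                 , trans (dot-+ʳ y u w) (cong₂ _xor_ yu yw)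

  -- A functional equal to 1 on both y and y + x vanishes on their sum x.
  separate-vanishing : (x y : Vect n) → y ≢ zeroVec n → y ≢ x → ∃ λ u → dot x u ≡ false × dot y u ≡ true
  separate-vanishing x y y≢0 y≢x with separate₂ y (y +ᵥ x) y≢0 (y≢x ∘ +ᵥ≡0⇒≡ y x)
  ... | u , yu , yxu = u , xu , yu
    where
    xu : dot x u ≡ false
    xu = trans (sym (cong (λ z → dot z u) (+ᵥ-cancelˡ y x)))
               (trans (dot-+ˡ y (y +ᵥ x) u) (cong₂ _xor_ yu yxu))

  -- The covering argument of `separate₂`, carried out among the functionals vanishing on x: if
  -- neither of two candidates serves y and z at once, their sum does and still kills x.
  separate₃ : (x y z : Vect n) → y ≢ zeroVec n → y ≢ x → z ≢ zeroVec n → z ≢ x →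
              ∃ λ u → dot x u ≡ false × dot y u ≡ true × dot z u ≡ true
  separate₃ x y z y≢0 y≢x z≢0 z≢x
    with separate-vanishing x y y≢0 y≢x | separate-vanishing x z z≢0 z≢x
  ... | u , xu , yu | w , xw , zw with dot z u in zu | dot y w in yw
  ...   | true  | _     = u , xu , yu , zu
  ...   | false | true  = w , xw , yw , zw
  ...   | false | false = u +ᵥ w , trans (dot-+ʳ x u w) (cong₂ _xor_ xu xw)
                                 , trans (dot-+ʳ y u w) (cong₂ _xor_ yu yw)
                                 , trans (dot-+ʳ z u w) (cong₂ _xor_ zu zw)

  transvection-fix : (u v x : Vect n) → dot x u ≡ false → transvection u v x ≡ x
  transvection-fix {n} u v x xu = dot-ext λ w → trans (dot-+ˡ x _ w)
    (trans (cong (dot x w xor_) (trans (dot-scale (dot x u) v w) (cong (_∧ dot v w) xu))) (xor-identityʳ _))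

  transvection-shift : (u v x : Vect n) → dot x u ≡ true → transvection u v x ≡ x +ᵥ v
  transvection-shift u v x xu = dot-ext λ w → trans (dot-+ˡ x _ w)
    (trans (cong (dot x w xor_) (trans (dot-scale (dot x u) v w) (cong (_∧ dot v w) xu))) (sym (dot-+ˡ x v w)))

  transvection-move : (u x y : Vect n) → dot x u ≡ true → transvection u (x +ᵥ y) x ≡ y
  transvection-move u x y xu = trans (transvection-shift u (x +ᵥ y) x xu) (+ᵥ-cancelˡ x y)

  dot-transvectionˡ : (u v x : Vect n) → dot v u ≡ false → dot (transvection u v x) u ≡ dot x u
  dot-transvectionˡ u v x vu = trans (dot-+ˡ x _ u)
    (trans (cong (dot x u xor_) (trans (dot-scale (dot x u) v u) (trans (cong (dot x u ∧_) vu) (∧-zeroʳ _))))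
           (xor-identityʳ _))

  transvection-involutive : (u v x : Vect n) → dot v u ≡ false → transvection u v (transvection u v x) ≡ x
  transvection-involutive u v x vu = begin
    (x +ᵥ scale (dot x u) v) +ᵥ scale (dot (transvection u v x) u) v
      ≡⟨ cong (λ b → (x +ᵥ scale (dot x u) v) +ᵥ scale b v) (dot-transvectionˡ u v x vu) ⟩
    (x +ᵥ scale (dot x u) v) +ᵥ scale (dot x u) v
      ≡⟨ +ᵥ-assoc x _ _ ⟩
    x +ᵥ (scale (dot x u) v +ᵥ scale (dot x u) v)
      ≡⟨ cong (x +ᵥ_) (+ᵥ-same (scale (dot x u) v)) ⟩
    x +ᵥ zeroVec _
      ≡⟨ +ᵥ-identityʳ x ⟩
    x ∎
    where open ≡-Reasoning

  -- Both sides expand to x · w + (x · u)(v · w), so passing to the adjoint exchanges u and v. This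
  -- is what lets a transvection of the rows commute with `_ᵥ·_`.
  dot-transvection : (u v x w : Vect n) → dot (transvection u v x) w ≡ dot x (transvection v u w)
  dot-transvection u v x w = begin
    dot (x +ᵥ scale (dot x u) v) w          ≡⟨ dot-+ˡ x _ w ⟩
    dot x w xor dot (scale (dot x u) v) w   ≡⟨ cong (dot x w xor_) (dot-scale (dot x u) v w) ⟩
    dot x w xor (dot x u ∧ dot v w)         ≡⟨ cong (dot x w xor_) (trans (∧-comm (dot x u) _) (cong₂ _∧_ (dot-comm v w) (dot-comm x u))) ⟩
    dot x w xor (dot w v ∧ dot u x)         ≡⟨ cong (dot x w xor_) (trans (sym (dot-scale (dot w v) u x)) (dot-comm _ x)) ⟩
    dot x w xor dot x (scale (dot w v) u)   ≡⟨ sym (dot-+ʳ x w _) ⟩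
    dot x (w +ᵥ scale (dot w v) u)          ∎
    where open ≡-Reasoning

  -- On the hyperplane x · u = 0 the map is the identity, and off it translation by v, which
  -- preserves x · u because v · u = 0. The sum is split accordingly and only one half is
  -- translated.
  ∑V-transvection : (u v : Vect n) → dot v u ≡ false →
                    ∀ (f : Vect n → ℕ) → ∑ (V n) (f ∘ transvection u v) ≡ ∑ (V n) f
  ∑V-transvection {n} u v vu f = begin
    ∑ (V n) (f ∘ transvection u v)
      ≡⟨ ∑-cong (V n) split-image ⟩
    ∑ (V n) (λ x → moved (v +ᵥ x) + fixed x)
      ≡⟨ ∑-+ (V n) _ _ ⟩
    ∑ (V n) (λ x → moved (v +ᵥ x)) + ∑ (V n) fixed
      ≡⟨ cong (_+ ∑ (V n) fixed) (∑V-translate v moved) ⟩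
    ∑ (V n) moved + ∑ (V n) fixed
      ≡⟨ sym (∑-+ (V n) _ _) ⟩
    ∑ (V n) (λ x → moved x + fixed x)
      ≡⟨ ∑-cong (V n) (λ x → split (dot x u) (f x)) ⟩
    ∑ (V n) f ∎
    where
    open ≡-Reasoning
    moved fixed : Vect n → ℕ
    moved x = 𝟙 (dot x u Bool.≟ true)  * f x
    fixed x = 𝟙 (dot x u Bool.≟ false) * f x
    split : ∀ b k → 𝟙 (b Bool.≟ true) * k + 𝟙 (b Bool.≟ false) * k ≡ k
    split true  k = trans (+-identityʳ _) (+-identityʳ k)
    split false k = +-identityʳ k
    dot-v+x : ∀ x → dot (v +ᵥ x) u ≡ dot x u
    dot-v+x x = trans (dot-+ˡ v x u) (cong (_xor dot x u) vu)
    split-image : ∀ x → f (transvection u v x) ≡ moved (v +ᵥ x) + fixed x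
    split-image x with dot x u in xu
    ... | true  = begin
      f (x +ᵥ scale true v)             ≡⟨ cong (λ b → f (x +ᵥ scale b v)) (sym xu) ⟩
      f (transvection u v x)            ≡⟨ cong f (trans (transvection-shift u v x xu) (+ᵥ-comm x v)) ⟩
      f (v +ᵥ x)                        ≡⟨ sym (trans (+-identityʳ _) (+-identityʳ _)) ⟩
      1 * f (v +ᵥ x) + 0                ≡⟨ cong (λ k → k * f (v +ᵥ x) + 0) (sym (𝟙-yes (dot (v +ᵥ x) u Bool.≟ true) (trans (dot-v+x x) xu))) ⟩
      moved (v +ᵥ x) + 0                ∎
    ... | false = begin
      f (x +ᵥ scale false v)            ≡⟨ cong (λ b → f (x +ᵥ scale b v)) (sym xu) ⟩
      f (transvection u v x)            ≡⟨ cong f (transvection-fix u v x xu) ⟩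
      f x                               ≡⟨ sym (+-identityʳ _) ⟩
      1 * f x                           ≡⟨ cong (λ k → k * f (v +ᵥ x) + 1 * f x) (sym (𝟙-no (dot (v +ᵥ x) u Bool.≟ true) λ eq → true≢false (trans (sym eq) (trans (dot-v+x x) xu)))) ⟩
      moved (v +ᵥ x) + 1 * f x          ∎

  -- Row vectors times matrices

  infixl 30 _ᵥ·_

  _ᵥ·_ : Vect m → Vec (Vect n) m → Vect n
  []      ᵥ· []      = zeroVec _
  (b ∷ a) ᵥ· (r ∷ M) = scale b r +ᵥ (a ᵥ· M)

  dot-ᵥ· : (a : Vect m) (M : Vec (Vect n) m) (w : Vect n) → dot (a ᵥ· M) w ≡ dot a (map (λ r → dot r w) M)
  dot-ᵥ· []      []      w = dot-zeroˡ w
  dot-ᵥ· (b ∷ a) (r ∷ M) w = trans (dot-+ˡ (scale b r) _ w) (cong₂ _xor_ (dot-scale b r w) (dot-ᵥ· a M w))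

  ᵥ·-+ : (a b : Vect m) (M : Vec (Vect n) m) → (a +ᵥ b) ᵥ· M ≡ (a ᵥ· M) +ᵥ (b ᵥ· M)
  ᵥ·-+ a b M = dot-ext λ w → begin
    dot ((a +ᵥ b) ᵥ· M) w                 ≡⟨ trans (dot-ᵥ· (a +ᵥ b) M w) (dot-+ˡ a b _) ⟩
    dot a _ xor dot b _                   ≡⟨ sym (cong₂ _xor_ (dot-ᵥ· a M w) (dot-ᵥ· b M w)) ⟩
    dot (a ᵥ· M) w xor dot (b ᵥ· M) w     ≡⟨ sym (dot-+ˡ (a ᵥ· M) (b ᵥ· M) w) ⟩
    dot ((a ᵥ· M) +ᵥ (b ᵥ· M)) w          ∎
    where open ≡-Reasoning

  ᵥ·-zero : (M : Vec (Vect n) m) → zeroVec m ᵥ· M ≡ zeroVec n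
  ᵥ·-zero M = dot-ext λ w → trans (dot-ᵥ· (zeroVec _) M w)
    (trans (dot-zeroˡ (map (λ r → dot r w) M)) (sym (dot-zeroˡ w)))

  -- Bridges the column-wise definition of the matrix product and the action on row vectors: after
  -- this, a product is read off row by row.
  map-dot-transpose : (a : Vect m) (M : Vec (Vect n) m) → map (dot a) (transpose M) ≡ a ᵥ· M
  map-dot-transpose {n = n} []      []      = lemma n
    where
    lemma : ∀ k → map (dot []) (replicate k []) ≡ zeroVec k
    lemma zero    = refl
    lemma (suc k) = cong (false ∷_) (lemma k)
  map-dot-transpose (b ∷ a) (r ∷ M) = trans (lemma r (transpose M)) (cong (scale b r +ᵥ_) (map-dot-transpose a M))
    where
    lemma : ∀ {k} (r : Vect k) X → map (dot (b ∷ a)) ((replicate k _∷_ ⊛ r) ⊛ X) ≡ scale b r +ᵥ map (dot a) X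
    lemma []      []      = refl
    lemma (c ∷ r) (x ∷ X) = cong (((b ∧ c) xor dot a x) ∷_) (lemma r X)

  ·ₘ-rows : (M N : Mat n) → M ·ₘ N ≡ map (_ᵥ· N) M
  ·ₘ-rows M N = map-cong (λ r → map-dot-transpose r N) M

  ᵥ·-assoc : (a : Vect m) (M : Vec (Vect n) m) (N : Mat n) → a ᵥ· map (_ᵥ· N) M ≡ (a ᵥ· M) ᵥ· N
  ᵥ·-assoc a M N = dot-ext λ w → begin
    dot (a ᵥ· map (_ᵥ· N) M) w                            ≡⟨ dot-ᵥ· a _ w ⟩
    dot a (map (λ r → dot r w) (map (_ᵥ· N) M))           ≡⟨ cong (dot a) (sym (map-∘ (λ r → dot r w) (_ᵥ· N) M)) ⟩
    dot a (map (λ r → dot (r ᵥ· N) w) M)                  ≡⟨ cong (dot a) (map-cong (λ r → dot-ᵥ· r N w) M) ⟩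
    dot a (map (λ r → dot r (map (λ s → dot s w) N)) M)   ≡⟨ sym (dot-ᵥ· a M _) ⟩
    dot (a ᵥ· M) (map (λ s → dot s w) N)                  ≡⟨ sym (dot-ᵥ· (a ᵥ· M) N w) ⟩
    dot ((a ᵥ· M) ᵥ· N) w                                 ∎
    where open ≡-Reasoning

  dot-unit : ∀ (i : Fin n) w → dot (tabulate λ j → ⌊ i Fin.≟ j ⌋) w ≡ lookup w i
  dot-unit zero    (b ∷ w) = trans (cong (b xor_) (dot-zeroˡ w)) (xor-identityʳ b)
  dot-unit (suc i) (b ∷ w) = trans
    (cong (λ u → dot u w) (tabulate-cong λ j → trans (isYes≗does (suc i Fin.≟ suc j)) (sym (isYes≗does (i Fin.≟ j)))))
    (dot-unit i w)

  idMat-·ᵥ : (w : Vect n) → idMat n ·ᵥ w ≡ w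
  idMat-·ᵥ w = trans (sym (tabulate-∘ (λ r → dot r w) _))
    (trans (tabulate-cong λ i → dot-unit i w) (tabulate∘lookup w))

  ᵥ·-idMat : (a : Vect n) → a ᵥ· idMat n ≡ a
  ᵥ·-idMat a = dot-ext λ w → trans (dot-ᵥ· a _ w) (cong (dot a) (idMat-·ᵥ w))

  ·ₘ-·ᵥ : (M N : Mat n) (w : Vect n) → (M ·ₘ N) ·ᵥ w ≡ M ·ᵥ (N ·ᵥ w)
  ·ₘ-·ᵥ M N w = begin
    (M ·ₘ N) ·ᵥ w                       ≡⟨ cong (_·ᵥ w) (·ₘ-rows M N) ⟩
    map (_ᵥ· N) M ·ᵥ w                  ≡⟨ sym (map-∘ (λ r → dot r w) (_ᵥ· N) M) ⟩
    map (λ r → dot (r ᵥ· N) w) M        ≡⟨ map-cong (λ r → dot-ᵥ· r N w) M ⟩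
    M ·ᵥ (N ·ᵥ w)                       ∎
    where open ≡-Reasoning

  ·ᵥ-+ᵥ : (M : Vec (Vect n) m) (u w : Vect n) →
          map (λ r → dot r (u +ᵥ w)) M ≡ map (λ r → dot r u) M +ᵥ map (λ r → dot r w) M
  ·ᵥ-+ᵥ []      u w = refl
  ·ᵥ-+ᵥ (r ∷ M) u w = cong₂ _∷_ (dot-+ʳ r u w) (·ᵥ-+ᵥ M u w)

  act-∙ : (g h : Aff n) (w : Vect n) → act (g ∙ h) w ≡ act g (act h w)
  act-∙ (M , v) (N , u) w = begin
    (v +ᵥ (M ·ᵥ u)) +ᵥ ((M ·ₘ N) ·ᵥ w)     ≡⟨ cong ((v +ᵥ (M ·ᵥ u)) +ᵥ_) (·ₘ-·ᵥ M N w) ⟩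
    (v +ᵥ (M ·ᵥ u)) +ᵥ (M ·ᵥ (N ·ᵥ w))     ≡⟨ +ᵥ-assoc v _ _ ⟩
    v +ᵥ ((M ·ᵥ u) +ᵥ (M ·ᵥ (N ·ᵥ w)))     ≡⟨ cong (v +ᵥ_) (sym (·ᵥ-+ᵥ M u (N ·ᵥ w))) ⟩
    v +ᵥ (M ·ᵥ (u +ᵥ (N ·ᵥ w)))            ∎
    where open ≡-Reasoning

  act-identity : (w : Vect n) → act (identity n) w ≡ w
  act-identity w = trans (+ᵥ-identityˡ _) (idMat-·ᵥ w)

  -- v₁ + v₂ lies in the image of M₁ + M₂, hence in the kernel of every functional killing M₁ + M₂.
  intersecting⇒dot≡ : {g₁ g₂ : Aff n} → Intersecting g₁ g₂ → ∀ a →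
                      a ᵥ· proj₁ g₁ ≡ a ᵥ· proj₁ g₂ → dot a (proj₂ g₁) ≡ dot a (proj₂ g₂)
  intersecting⇒dot≡ {g₁ = g₁@(M₁ , v₁)} {g₂@(M₂ , v₂)} (h , _ , g₂h≡1 , w , fixed) a aM = begin
    dot a v₁                                              ≡⟨ sym (xor-cancelʳ _ (dot a (M₁ ·ᵥ u))) ⟩
    (dot a v₁ xor dot a (M₁ ·ᵥ u)) xor dot a (M₁ ·ᵥ u)    ≡⟨ cong₂ _xor_ (trans (sym (dot-+ʳ a v₁ _)) (trans (cong (dot a) common) (dot-+ʳ a v₂ _))) same ⟩
    (dot a v₂ xor dot a (M₂ ·ᵥ u)) xor dot a (M₂ ·ᵥ u)    ≡⟨ xor-cancelʳ _ (dot a (M₂ ·ᵥ u)) ⟩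
    dot a v₂                                              ∎
    where
    open ≡-Reasoning
    u = act h w
    common : act g₁ u ≡ act g₂ u
    common = trans (trans (sym (act-∙ g₁ h w)) fixed)
      (sym (trans (sym (act-∙ g₂ h w)) (trans (cong (λ g → act g w) g₂h≡1) (act-identity w))))
    same : dot a (M₁ ·ᵥ u) ≡ dot a (M₂ ·ᵥ u)
    same = trans (sym (dot-ᵥ· a M₁ u)) (trans (cong (λ r → dot r u) aM) (dot-ᵥ· a M₂ u))

  -- The general linear group

  ∈-vecsOver : {xs : List A} → (∀ x → x ∈ xs) → (v : Vec A m) → v ∈ vecsOver xs m
  ∈-vecsOver all []      = here refl
  ∈-vecsOver all (x ∷ v) = ∈-concatMap⁺ _ (lose (all x) (∈-map⁺ (x ∷_) (∈-vecsOver all v)))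

  ∈-allMats : (M : Mat n) → M ∈ allMats n
  ∈-allMats = ∈-vecsOver (∈-vecsOver λ { true → here refl ; false → there (here refl) })

  -- Decides the Boolean test inside `glOrder`, so that `∑GL` of the constant 1 counts exactly what
  -- `glOrder` counts.
  Invertible? : (M : Mat n) → Dec (invertibleᵇ M ≡ true)
  Invertible? M = invertibleᵇ M Bool.≟ true

  inverseᵇ : (M N : Mat n) → Bool
  inverseᵇ {n} M N = ⌊ matDec (M ·ₘ N) (idMat n) ⌋ ∧ ⌊ matDec (N ·ₘ M) (idMat n) ⌋

  invertibleᵇ⇒Invertible : (M : Mat n) → invertibleᵇ M ≡ true → Invertible M
  invertibleᵇ⇒Invertible {n} M eq with satisfied (any⁻ (inverseᵇ M) (allMats n) (Equivalence.from T-≡ eq))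
  ... | N , t with Equivalence.to (T-∧ {⌊ matDec (M ·ₘ N) (idMat n) ⌋}) t
  ...   | t₁ , t₂ = N , toWitness {a? = matDec (M ·ₘ N) (idMat n)} t₁ , toWitness {a? = matDec (N ·ₘ M) (idMat n)} t₂

  Invertible⇒invertibleᵇ : (M : Mat n) → Invertible M → invertibleᵇ M ≡ true
  Invertible⇒invertibleᵇ {n} M (N , MN , NM) = Equivalence.to T-≡ (any⁺ (inverseᵇ M)
    (lose (∈-allMats N) (Equivalence.from T-∧
      (fromWitness {a? = matDec (M ·ₘ N) (idMat n)} MN , fromWitness {a? = matDec (N ·ₘ M) (idMat n)} NM))))

  ᵥ·-injective : (M : Mat n) → Invertible M → (a b : Vect n) → a ᵥ· M ≡ b ᵥ· M → a ≡ b
  ᵥ·-injective {n} M (N , MN , _) a b eq = trans (sym (undo a)) (trans (cong (_ᵥ· N) eq) (undo b))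
    where
    undo : ∀ a → (a ᵥ· M) ᵥ· N ≡ a
    undo a = trans (sym (ᵥ·-assoc a M N)) (trans (cong (a ᵥ·_) (trans (sym (·ₘ-rows M N)) MN)) (ᵥ·-idMat a))

  idMat-Invertible : ∀ n → Invertible (idMat n)
  idMat-Invertible n = idMat n , id² , id²
    where
    id² : idMat n ·ₘ idMat n ≡ idMat n
    id² = trans (·ₘ-rows _ _) (trans (map-cong ᵥ·-idMat _) (map-id _))

  ᵥ·-transvection : (u v : Vect n) (a : Vect m) (M : Vec (Vect n) m) →
                    a ᵥ· map (transvection u v) M ≡ transvection u v (a ᵥ· M)
  ᵥ·-transvection u v a M = dot-ext λ w → begin
    dot (a ᵥ· map (transvection u v) M) w                ≡⟨ dot-ᵥ· a _ w ⟩
    dot a (map (λ r → dot r w) (map (transvection u v) M)) ≡⟨ cong (dot a) (sym (map-∘ (λ r → dot r w) (transvection u v) M)) ⟩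
    dot a (map (λ r → dot (transvection u v r) w) M)     ≡⟨ cong (dot a) (map-cong (λ r → dot-transvection u v r w) M) ⟩
    dot a (map (λ r → dot r (transvection v u w)) M)     ≡⟨ sym (dot-ᵥ· a M _) ⟩
    dot (a ᵥ· M) (transvection v u w)                    ≡⟨ sym (dot-transvection u v (a ᵥ· M) w) ⟩
    dot (transvection u v (a ᵥ· M)) w                    ∎
    where open ≡-Reasoning

  Invertible-transvection : (u v : Vect n) → dot v u ≡ false → (M : Mat n) →
                            Invertible M → Invertible (map (transvection u v) M)
  Invertible-transvection {n} u v vu M (N , MN , NM) = N′ , M′N′ , N′M′
    where
    open ≡-Reasoning
    τ = transvection u v
    M′ = map τ M
    -- With T the matrix of the involution τ, M′ is M T, and its inverse is T N.
    N′ = map (_ᵥ· N) (map τ (idMat n))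
    ττ : ∀ x → τ (τ x) ≡ x
    ττ x = transvection-involutive u v x vu
    M′N′ : M′ ·ₘ N′ ≡ idMat n
    M′N′ = begin
      M′ ·ₘ N′                        ≡⟨ ·ₘ-rows M′ N′ ⟩
      map (_ᵥ· N′) (map τ M)          ≡⟨ sym (map-∘ (_ᵥ· N′) τ M) ⟩
      map (λ r → τ r ᵥ· N′) M         ≡⟨ map-cong row M ⟩
      map (_ᵥ· N) M                   ≡⟨ trans (sym (·ₘ-rows M N)) MN ⟩
      idMat n                         ∎
      where
      row : ∀ r → τ r ᵥ· N′ ≡ r ᵥ· N
      row r = trans (ᵥ·-assoc (τ r) (map τ (idMat n)) N) (cong (_ᵥ· N)
        (trans (ᵥ·-transvection u v (τ r) (idMat n)) (trans (cong τ (ᵥ·-idMat (τ r))) (ττ r))))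
    N′M′ : N′ ·ₘ M′ ≡ idMat n
    N′M′ = begin
      N′ ·ₘ M′                                          ≡⟨ ·ₘ-rows N′ M′ ⟩
      map (_ᵥ· M′) (map (_ᵥ· N) (map τ (idMat n)))      ≡⟨ sym (trans (map-∘ (λ x → (x ᵥ· N) ᵥ· M′) τ (idMat n)) (map-∘ (_ᵥ· M′) (_ᵥ· N) _)) ⟩
      map (λ e → (τ e ᵥ· N) ᵥ· M′) (idMat n)            ≡⟨ map-cong row (idMat n) ⟩
      map (λ e → e) (idMat n)                           ≡⟨ map-id (idMat n) ⟩
      idMat n                                           ∎
      where
      row : ∀ e → (τ e ᵥ· N) ᵥ· M′ ≡ e
      row e = begin
        (τ e ᵥ· N) ᵥ· M′              ≡⟨ ᵥ·-transvection u v (τ e ᵥ· N) M ⟩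
        τ ((τ e ᵥ· N) ᵥ· M)           ≡⟨ cong τ (sym (ᵥ·-assoc (τ e) N M)) ⟩
        τ (τ e ᵥ· map (_ᵥ· M) N)      ≡⟨ cong (λ X → τ (τ e ᵥ· X)) (trans (sym (·ₘ-rows N M)) NM) ⟩
        τ (τ e ᵥ· idMat n)            ≡⟨ cong τ (ᵥ·-idMat (τ e)) ⟩
        τ (τ e)                       ≡⟨ ττ e ⟩
        e                             ∎

  ∑GL : ∀ n → (Mat n → ℕ) → ℕ
  ∑GL n f = ∑ (allMats n) λ M → 𝟙 (Invertible? M) * f M

  glOrder≡∑GL : ∀ n → glOrder n ≡ ∑GL n (λ _ → 1)
  glOrder≡∑GL n = lemma (allMats n)
    where
    lemma : ∀ Ms → countᵇ invertibleᵇ Ms ≡ ∑ Ms (λ M → 𝟙 (Invertible? M) * 1)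
    lemma []       = refl
    lemma (M ∷ Ms) with invertibleᵇ M
    ... | true  = cong suc (lemma Ms)
    ... | false = lemma Ms

  glOrder>0 : ∀ n → 0 < glOrder n
  glOrder>0 n = begin
    1                        ≡⟨ sym (cong (_* 1) (𝟙-yes (Invertible? (idMat n)) (Invertible⇒invertibleᵇ _ (idMat-Invertible n)))) ⟩
    𝟙 (Invertible? (idMat n)) * 1  ≤⟨ ∑-single (allMats n) _ (∈-allMats (idMat n)) ⟩
    ∑GL n (λ _ → 1)          ≡⟨ sym (glOrder≡∑GL n) ⟩
    glOrder n                ∎
    where open ≤-Reasoning

  -- Right multiplication by a transvection permutes all matrices and preserves invertibility in
  -- both directions, the map being its own inverse. All transitivity statements below rest on this
  -- substitution.
  ∑GL-transvection : (u v : Vect n) → dot v u ≡ false → (f : Mat n → ℕ) →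
                     ∑GL n (f ∘ map (transvection u v)) ≡ ∑GL n f
  ∑GL-transvection {n} u v vu f = trans
    (∑-cong (allMats n) λ M → cong (_* f (map τ M))
      (𝟙-cong (Invertible? M) (Invertible? (map τ M)) (forth M) (back M)))
    (∑-vecsOver-map (V n) τ (∑V-transvection u v vu) n _)
    where
    τ = transvection u v
    forth : ∀ M → invertibleᵇ M ≡ true → invertibleᵇ (map τ M) ≡ true
    forth M = Invertible⇒invertibleᵇ _ ∘ Invertible-transvection u v vu M ∘ invertibleᵇ⇒Invertible M
    ττ : ∀ M → map τ (map τ M) ≡ M
    ττ M = trans (sym (map-∘ τ τ M)) (trans (map-cong (λ x → transvection-involutive u v x vu) M) (map-id M))
    back : ∀ M → invertibleᵇ (map τ M) ≡ true → invertibleᵇ M ≡ true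
    back M = subst (λ X → invertibleᵇ X ≡ true) (ττ M) ∘ forth (map τ M)

  -- Pairs of vectors and independent pairs

  ∑-cartesianProduct : (xs : List A) (ys : List B) (f : A × B → ℕ) →
                       ∑ (cartesianProduct xs ys) f ≡ ∑ xs λ x → ∑ ys λ y → f (x , y)
  ∑-cartesianProduct []       ys f = refl
  ∑-cartesianProduct (x ∷ xs) ys f = trans (∑-++ (List.map (x ,_) ys) _ f)
    (cong₂ _+_ (∑-map ys (x ,_) f) (∑-cartesianProduct xs ys f))

  VV : ∀ n → List (Vect n × Vect n)
  VV n = cartesianProduct (V n) (V n)

  ∑VV-enumerates : (x y : Vect n) (f : Vect n × Vect n → ℕ) →
    ∑ (VV n) (λ (x′ , y′) → 𝟙 (x′ ≟ᵥ x) * 𝟙 (y′ ≟ᵥ y) * f (x′ , y′)) ≡ f (x , y)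
  ∑VV-enumerates {n} x y f = begin
    ∑ (VV n) (λ (x′ , y′) → 𝟙 (x′ ≟ᵥ x) * 𝟙 (y′ ≟ᵥ y) * f (x′ , y′))
      ≡⟨ ∑-cartesianProduct (V n) (V n) _ ⟩
    ∑ (V n) (λ x′ → ∑ (V n) λ y′ → 𝟙 (x′ ≟ᵥ x) * 𝟙 (y′ ≟ᵥ y) * f (x′ , y′))
      ≡⟨ ∑-cong (V n) (λ x′ → trans (∑-cong (V n) λ y′ → *-assoc (𝟙 (x′ ≟ᵥ x)) _ _) (∑-*ˡ (V n) (𝟙 (x′ ≟ᵥ x)) _)) ⟩
    ∑ (V n) (λ x′ → 𝟙 (x′ ≟ᵥ x) * ∑ (V n) λ y′ → 𝟙 (y′ ≟ᵥ y) * f (x′ , y′))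
      ≡⟨ V-enumerates n x _ ⟩
    ∑ (V n) (λ y′ → 𝟙 (y′ ≟ᵥ y) * f (x , y′))
      ≡⟨ V-enumerates n y _ ⟩
    f (x , y) ∎
    where open ≡-Reasoning

  Nonzero? : (x : Vect n) → Dec (x ≢ zeroVec n)
  Nonzero? x = ¬? (x ≟ᵥ zeroVec _)

  -- Over F₂ these are the linearly independent pairs.
  Independent : Vect n × Vect n → Set
  Independent {n} (x , y) = x ≢ zeroVec n × y ≢ zeroVec n × y ≢ x

  Independent? : (p : Vect n × Vect n) → Dec (Independent p)
  Independent? (x , y) = Nonzero? x ×-dec Nonzero? y ×-dec ¬? (y ≟ᵥ x)

  nonzeros : ℕ → ℕ
  nonzeros n = ∑ (V n) λ x → 𝟙 (Nonzero? x)

  frames : ℕ → ℕ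
  frames n = ∑ (VV n) λ p → 𝟙 (Independent? p)

  𝟙-¬ : {P : Set} (d : Dec P) → 𝟙 (¬? d) + 𝟙 d ≡ 1
  𝟙-¬ (yes _) = refl
  𝟙-¬ (no _)  = refl

  nonzeros+1 : ∀ n → nonzeros n + 1 ≡ 2 ^ n
  nonzeros+1 n = begin
    nonzeros n + 1                                          ≡⟨ cong (nonzeros n +_) (sym (∑V-single (zeroVec n))) ⟩
    nonzeros n + ∑ (V n) (λ x → 𝟙 (x ≟ᵥ zeroVec n))         ≡⟨ sym (∑-+ (V n) _ _) ⟩
    ∑ (V n) (λ x → 𝟙 (Nonzero? x) + 𝟙 (x ≟ᵥ zeroVec n))     ≡⟨ ∑-cong (V n) (λ x → 𝟙-¬ (x ≟ᵥ zeroVec n)) ⟩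
    ∑ (V n) (λ _ → 1)                                       ≡⟨ ∑V-1 n ⟩
    2 ^ n                                                   ∎
    where open ≡-Reasoning

  -- Over F₂ a pair of nonzero vectors is either independent or a repetition. The repetitions are
  -- added on the left, which avoids truncated subtraction.
  frames+nonzeros : ∀ n → frames n + nonzeros n ≡ nonzeros n * nonzeros n
  frames+nonzeros n = begin
    frames n + nonzeros n
      ≡⟨ cong₂ _+_ (∑-cartesianProduct (V n) (V n) _) (∑-cong (V n) λ x → sym (trans (cong (𝟙 (Nonzero? x) *_) (∑V-single x)) (*-identityʳ _))) ⟩
    ∑ (V n) (λ x → ∑ (V n) λ y → 𝟙 (Independent? (x , y))) + ∑ (V n) (λ x → 𝟙 (Nonzero? x) * ∑ (V n) λ y → 𝟙 (y ≟ᵥ x))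
      ≡⟨ sym (∑-+ (V n) _ _) ⟩
    ∑ (V n) (λ x → ∑ (V n) (λ y → 𝟙 (Independent? (x , y))) + 𝟙 (Nonzero? x) * ∑ (V n) λ y → 𝟙 (y ≟ᵥ x))
      ≡⟨ ∑-cong (V n) (λ x → trans (cong (∑ (V n) (λ y → 𝟙 (Independent? (x , y))) +_) (sym (∑-*ˡ (V n) (𝟙 (Nonzero? x)) _))) (sym (∑-+ (V n) _ _))) ⟩
    ∑ (V n) (λ x → ∑ (V n) λ y → 𝟙 (Independent? (x , y)) + 𝟙 (Nonzero? x) * 𝟙 (y ≟ᵥ x))
      ≡⟨ ∑-cong (V n) (λ x → ∑-cong (V n) λ y → split x y (x ≟ᵥ zeroVec n) (y ≟ᵥ zeroVec n) (y ≟ᵥ x)) ⟩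
    ∑ (V n) (λ x → ∑ (V n) λ y → 𝟙 (Nonzero? x) * 𝟙 (Nonzero? y))
      ≡⟨ ∑-product (V n) (V n) _ _ ⟩
    nonzeros n * nonzeros n ∎
    where
    open ≡-Reasoning
    split : ∀ (x y : Vect n) (d : Dec (x ≡ zeroVec n)) (e : Dec (y ≡ zeroVec n)) (c : Dec (y ≡ x)) →
            𝟙 (¬? d ×-dec ¬? e ×-dec ¬? c) + 𝟙 (¬? d) * 𝟙 c ≡ 𝟙 (¬? d) * 𝟙 (¬? e)
    split x y (yes _)  e        c          = refl
    split x y (no x≢0) (yes y≡0) (yes y≡x) = ⊥-elim (x≢0 (trans (sym y≡x) y≡0))
    split x y (no x≢0) (yes y≡0) (no y≢x)  = refl
    split x y (no x≢0) (no y≢0) (yes y≡x)  = refl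
    split x y (no x≢0) (no y≢0) (no y≢x)   = refl

  dependents : ℕ → ℕ
  dependents n = ∑ (VV n) λ p → 𝟙 (¬? (Independent? p))

  ∑VV-1 : ∀ n → ∑ (VV n) (λ _ → 1) ≡ 2 ^ n * 2 ^ n
  ∑VV-1 n = trans (∑-cartesianProduct (V n) (V n) _)
    (trans (∑-product (V n) (V n) (λ _ → 1) (λ _ → 1)) (cong₂ _*_ (∑V-1 n) (∑V-1 n)))

  dependents+frames : ∀ n → dependents n + frames n ≡ 2 ^ n * 2 ^ n
  dependents+frames n = trans (sym (∑-+ (VV n) _ _))
    (trans (∑-cong (VV n) λ p → 𝟙-¬ (Independent? p)) (∑VV-1 n))

  frames≤ : ∀ n → frames n ≤ 2 ^ n * 2 ^ n
  frames≤ n = ≤-trans (m≤n+m (frames n) (dependents n)) (≤-reflexive (dependents+frames n))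

  ∑GL-mono : {f g : Mat n → ℕ} → (∀ M → Invertible M → f M ≤ g M) → ∑GL n f ≤ ∑GL n g
  ∑GL-mono {n} {f} {g} f≤g = ∑-mono (allMats n) λ M → lemma M (Invertible? M)
    where
    lemma : ∀ M (d : Dec (invertibleᵇ M ≡ true)) → 𝟙 d * f M ≤ 𝟙 d * g M
    lemma M (yes p) = *-monoʳ-≤ 1 (f≤g M (invertibleᵇ⇒Invertible M p))
    lemma M (no _)  = z≤n

  ∑GL-cong : {f g : Mat n → ℕ} → (∀ M → Invertible M → f M ≡ g M) → ∑GL n f ≡ ∑GL n g
  ∑GL-cong f≡g = ≤-antisym (∑GL-mono λ M inv → ≤-reflexive (f≡g M inv))
                           (∑GL-mono λ M inv → ≤-reflexive (sym (f≡g M inv)))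

  ∑GL-∑ : ∀ n (xs : List A) (f : Mat n → A → ℕ) → ∑GL n (λ M → ∑ xs (f M)) ≡ ∑ xs λ x → ∑GL n λ M → f M x
  ∑GL-∑ n xs f = trans (∑-cong (allMats n) λ M → sym (∑-*ˡ xs (𝟙 (Invertible? M)) (f M))) (∑-swap (allMats n) xs _)

  ∑GL-*ˡ : ∀ n (c : ℕ) (f : Mat n → ℕ) → ∑GL n (λ M → c * f M) ≡ c * ∑GL n f
  ∑GL-*ˡ n c f = trans (∑-cong (allMats n) λ M → lemma (𝟙 (Invertible? M)) c (f M)) (∑-*ˡ (allMats n) c _)
    where
    lemma : ∀ i c k → i * (c * k) ≡ c * (i * k)
    lemma = solve-∀

  ∑GL-+ : ∀ n (f g : Mat n → ℕ) → ∑GL n (λ M → f M + g M) ≡ ∑GL n f + ∑GL n g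
  ∑GL-+ n f g = trans (∑-cong (allMats n) λ M → *-distribˡ-+ (𝟙 (Invertible? M)) _ _) (∑-+ (allMats n) _ _)

  -- Fibres of the action of GL(n,2) on vectors and on pairs

  fibre₁ : Vect n → Vect n → ℕ
  fibre₁ {n} a x = ∑GL n λ M → 𝟙 (x ≟ᵥ a ᵥ· M)

  fibre₂ : Vect n × Vect n → Vect n × Vect n → ℕ
  fibre₂ {n} (a , b) (x , y) = ∑GL n λ M → 𝟙 (x ≟ᵥ a ᵥ· M) * 𝟙 (y ≟ᵥ b ᵥ· M)

  𝟙-transvection : (u v : Vect n) → dot v u ≡ false → ∀ x z →
                   𝟙 (transvection u v x ≟ᵥ transvection u v z) ≡ 𝟙 (x ≟ᵥ z)
  𝟙-transvection u v vu x z = 𝟙-cong (transvection u v x ≟ᵥ transvection u v z) (x ≟ᵥ z)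
    (λ eq → trans (sym (transvection-involutive u v x vu))
                  (trans (cong (transvection u v) eq) (transvection-involutive u v z vu)))
    (cong (transvection u v))

  𝟙-ᵥ·-transvection : (u v : Vect n) → dot v u ≡ false → ∀ a x (M : Mat n) →
    𝟙 (transvection u v x ≟ᵥ a ᵥ· map (transvection u v) M) ≡ 𝟙 (x ≟ᵥ a ᵥ· M)
  𝟙-ᵥ·-transvection u v vu a x M = trans
    (cong (λ z → 𝟙 (transvection u v x ≟ᵥ z)) (ᵥ·-transvection u v a M))
    (𝟙-transvection u v vu x (a ᵥ· M))

  fibre₁-transvection : (u v : Vect n) → dot v u ≡ false → ∀ a x → fibre₁ a (transvection u v x) ≡ fibre₁ a x
  fibre₁-transvection u v vu a x = trans
    (sym (∑GL-transvection u v vu λ M → 𝟙 (transvection u v x ≟ᵥ a ᵥ· M)))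
    (∑GL-cong λ M _ → 𝟙-ᵥ·-transvection u v vu a x M)

  fibre₂-transvection : (u v : Vect n) → dot v u ≡ false → ∀ ab x y →
    fibre₂ ab (transvection u v x , transvection u v y) ≡ fibre₂ ab (x , y)
  fibre₂-transvection u v vu (a , b) x y = trans
    (sym (∑GL-transvection u v vu λ M → 𝟙 (transvection u v x ≟ᵥ a ᵥ· M) * 𝟙 (transvection u v y ≟ᵥ b ᵥ· M)))
    (∑GL-cong λ M _ → cong₂ _*_ (𝟙-ᵥ·-transvection u v vu a x M) (𝟙-ᵥ·-transvection u v vu b y M))

  dot-+-same : (x y u : Vect n) → dot x u ≡ true → dot y u ≡ true → dot (x +ᵥ y) u ≡ false
  dot-+-same x y u xu yu = trans (dot-+ˡ x y u) (cong₂ _xor_ xu yu)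

  -- With u equal to 1 on both x and y, the transvection along x + y is admissible and carries x to
  -- y.
  fibre₁-const : (a x y : Vect n) → x ≢ zeroVec n → y ≢ zeroVec n → fibre₁ a x ≡ fibre₁ a y
  fibre₁-const a x y x≢0 y≢0 with separate₂ x y x≢0 y≢0
  ... | u , xu , yu = trans (sym (fibre₁-transvection u (x +ᵥ y) (dot-+-same x y u xu yu) a x))
                            (cong (fibre₁ a) (transvection-move u x y xu))

  -- Two moves suffice: one transvection takes x to x′ and carries y along to some z; a second one,
  -- along a functional vanishing on x′, takes z to y′ while leaving x′ in place.
  fibre₂-const : (ab p q : Vect n × Vect n) → Independent p → Independent q → fibre₂ ab p ≡ fibre₂ ab q
  fibre₂-const {n} ab (x , y) (x′ , y′) (x≢0 , y≢0 , y≢x) (x′≢0 , y′≢0 , y′≢x′) = move₁ (separate₂ x x′ x≢0 x′≢0)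
    where
    open ≡-Reasoning
    move₂ : ∀ z → z ≢ zeroVec n → z ≢ x′ → fibre₂ ab (x′ , z) ≡ fibre₂ ab (x′ , y′)
    move₂ z z≢0 z≢x′ = along (separate₃ x′ z y′ z≢0 z≢x′ y′≢0 y′≢x′)
      where
      along : (∃ λ w → dot x′ w ≡ false × dot z w ≡ true × dot y′ w ≡ true) →
              fibre₂ ab (x′ , z) ≡ fibre₂ ab (x′ , y′)
      along (w , x′w , zw , y′w) = begin
        fibre₂ ab (x′ , z)
          ≡⟨ sym (fibre₂-transvection w (z +ᵥ y′) (dot-+-same z y′ w zw y′w) ab x′ z) ⟩
        fibre₂ ab (transvection w (z +ᵥ y′) x′ , transvection w (z +ᵥ y′) z)
          ≡⟨ cong₂ (λ s t → fibre₂ ab (s , t)) (transvection-fix w (z +ᵥ y′) x′ x′w) (transvection-move w z y′ zw) ⟩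
        fibre₂ ab (x′ , y′) ∎
    move₁ : (∃ λ u → dot x u ≡ true × dot x′ u ≡ true) → fibre₂ ab (x , y) ≡ fibre₂ ab (x′ , y′)
    move₁ (u , xu , x′u) = begin
      fibre₂ ab (x , y)
        ≡⟨ sym (fibre₂-transvection u (x +ᵥ x′) vu ab x y) ⟩
      fibre₂ ab (τ x , τ y)
        ≡⟨ cong (λ t → fibre₂ ab (t , τ y)) (transvection-move u x x′ xu) ⟩
      fibre₂ ab (x′ , τ y)
        ≡⟨ move₂ (τ y) z≢0 z≢x′ ⟩
      fibre₂ ab (x′ , y′) ∎
      where
      τ : Vect n → Vect n
      τ = transvection u (x +ᵥ x′)
      vu : dot (x +ᵥ x′) u ≡ false
      vu = dot-+-same x x′ u xu x′u
      undo : ∀ {w} → τ y ≡ w → y ≡ τ w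
      undo eq = trans (sym (transvection-involutive u (x +ᵥ x′) y vu)) (cong τ eq)
      -- τ is an involution that fixes 0 and sends x to x′, so τ y avoids 0 and x′ because y avoids
      -- 0 and x.
      z≢0 : τ y ≢ zeroVec n
      z≢0 eq = y≢0 (trans (undo eq) (transvection-fix u (x +ᵥ x′) (zeroVec n) (dot-zeroˡ u)))
      z≢x′ : τ y ≢ x′
      z≢x′ eq = y≢x (trans (undo (trans eq (sym (transvection-move u x x′ xu))))
                           (transvection-involutive u (x +ᵥ x′) x vu))

  ᵥ·-nonzero : (M : Mat n) → Invertible M → ∀ {a} → a ≢ zeroVec n → a ᵥ· M ≢ zeroVec n
  ᵥ·-nonzero M inv a≢0 eq = a≢0 (ᵥ·-injective M inv _ _ (trans eq (sym (ᵥ·-zero M))))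

  ᵥ·-Independent : (M : Mat n) → Invertible M → ∀ {a b} → Independent (a , b) → Independent (a ᵥ· M , b ᵥ· M)
  ᵥ·-Independent M inv (a≢0 , b≢0 , b≢a) =
    ᵥ·-nonzero M inv a≢0 , ᵥ·-nonzero M inv b≢0 , b≢a ∘ ᵥ·-injective M inv _ _

  -- Double counting: each invertible M lies over exactly one nonzero y = a M, and all these fibres
  -- have equal size.
  nonzeros*fibre₁ : (a x : Vect n) → a ≢ zeroVec n → x ≢ zeroVec n → nonzeros n * fibre₁ a x ≡ glOrder n
  nonzeros*fibre₁ {n} a x a≢0 x≢0 = begin
    nonzeros n * fibre₁ a x
      ≡⟨ sym (∑-*ʳ (V n) (fibre₁ a x) _) ⟩
    ∑ (V n) (λ y → 𝟙 (Nonzero? y) * fibre₁ a x)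
      ≡⟨ ∑-cong (V n) (λ y → const y (Nonzero? y)) ⟩
    ∑ (V n) (λ y → ∑GL n λ M → 𝟙 (Nonzero? y) * 𝟙 (y ≟ᵥ a ᵥ· M))
      ≡⟨ sym (∑GL-∑ n (V n) _) ⟩
    ∑GL n (λ M → ∑ (V n) λ y → 𝟙 (Nonzero? y) * 𝟙 (y ≟ᵥ a ᵥ· M))
      ≡⟨ ∑GL-cong (λ M inv → trans (∑-cong (V n) λ y → *-comm (𝟙 (Nonzero? y)) _)
           (trans (V-enumerates n (a ᵥ· M) _) (𝟙-yes (Nonzero? (a ᵥ· M)) (ᵥ·-nonzero M inv a≢0)))) ⟩
    ∑GL n (λ _ → 1)
      ≡⟨ sym (glOrder≡∑GL n) ⟩
    glOrder n ∎
    where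
    open ≡-Reasoning
    const : ∀ y (d : Dec (y ≢ zeroVec n)) →
            𝟙 d * fibre₁ a x ≡ ∑GL n λ M → 𝟙 d * 𝟙 (y ≟ᵥ a ᵥ· M)
    const y (yes y≢0) = trans (cong (1 *_) (fibre₁-const a x y x≢0 y≢0)) (sym (∑GL-*ˡ n 1 _))
    const y (no _)    = sym (∑GL-*ˡ n 0 λ M → 𝟙 (y ≟ᵥ a ᵥ· M))

  ∑fibre₂ : (ab : Vect n × Vect n) → Independent ab →
            ∑ (VV n) (λ p → 𝟙 (Independent? p) * fibre₂ ab p) ≡ glOrder n
  ∑fibre₂ {n} ab@(a , b) ind = begin
    ∑ (VV n) (λ p → 𝟙 (Independent? p) * fibre₂ ab p)
      ≡⟨ ∑-cong (VV n) (λ p → sym (∑GL-*ˡ n (𝟙 (Independent? p)) _)) ⟩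
    ∑ (VV n) (λ p@(x , y) → ∑GL n λ M → 𝟙 (Independent? p) * (𝟙 (x ≟ᵥ a ᵥ· M) * 𝟙 (y ≟ᵥ b ᵥ· M)))
      ≡⟨ sym (∑GL-∑ n (VV n) _) ⟩
    ∑GL n (λ M → ∑ (VV n) λ p@(x , y) → 𝟙 (Independent? p) * (𝟙 (x ≟ᵥ a ᵥ· M) * 𝟙 (y ≟ᵥ b ᵥ· M)))
      ≡⟨ ∑GL-cong (λ M inv → trans (∑-cong (VV n) λ p → *-comm (𝟙 (Independent? p)) _)
           (trans (∑VV-enumerates (a ᵥ· M) (b ᵥ· M) (λ p → 𝟙 (Independent? p)))
                  (𝟙-yes (Independent? (a ᵥ· M , b ᵥ· M)) (ᵥ·-Independent M inv ind)))) ⟩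
    ∑GL n (λ _ → 1)
      ≡⟨ sym (glOrder≡∑GL n) ⟩
    glOrder n ∎
    where open ≡-Reasoning

  frames*fibre₂ : (ab p : Vect n × Vect n) → Independent ab → Independent p → frames n * fibre₂ ab p ≡ glOrder n
  frames*fibre₂ {n} ab p ind-ab ind-p = begin
    frames n * fibre₂ ab p
      ≡⟨ sym (∑-*ʳ (VV n) (fibre₂ ab p) _) ⟩
    ∑ (VV n) (λ q → 𝟙 (Independent? q) * fibre₂ ab p)
      ≡⟨ ∑-cong (VV n) (λ q → const q (Independent? q)) ⟩
    ∑ (VV n) (λ q → 𝟙 (Independent? q) * fibre₂ ab q)
      ≡⟨ ∑fibre₂ ab ind-ab ⟩
    glOrder n ∎
    where
    open ≡-Reasoning
    const : ∀ q (d : Dec (Independent q)) → 𝟙 d * fibre₂ ab p ≡ 𝟙 d * fibre₂ ab q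
    const q (yes ind-q) = cong (1 *_) (fibre₂-const ab p q ind-p ind-q)
    const q (no _)      = refl

  -- Counting over an intersecting set

  count-≤1 : {D : A → Set} (D? : ∀ x → Dec (D x)) {xs : List A} → Unique xs →
             (∀ {x y} → x ∈ xs → y ∈ xs → D x → D y → x ≡ y) → ∑ xs (λ x → 𝟙 (D? x)) ≤ 1
  count-≤1 D? {[]}     uniq eq = z≤n
  count-≤1 D? {x ∷ xs} (x∉xs ∷ uniq) eq with D? x
  ... | no _  = count-≤1 D? uniq λ x∈ y∈ → eq (there x∈) (there y∈)
  ... | yes d = +-monoʳ-≤ 1 (≤-trans
    (∑-mono-∈ xs λ {y} y∈ → ≤-reflexive (𝟙-no (D? y) λ d′ → All.lookup x∉xs y∈ (eq (here refl) (there y∈) d d′)))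
    (≤-reflexive (∑-0 xs)))

  -- An intersecting set contains at most one element over each matrix.
  ∑≤∑GL : {S : List (Aff n)} → Unique S → All IsAGL S → IntersectingSet S →
          (f : Mat n → ℕ) → ∑ S (λ g → f (proj₁ g)) ≤ ∑GL n f
  ∑≤∑GL {n} {S} uniq agl int f = begin
    ∑ S (λ g → f (proj₁ g))
      ≡⟨ ∑-cong S (λ g → sym (vecsOver-enumerates _≟ᵥ_ (V n) (V-enumerates n) n (proj₁ g) f)) ⟩
    ∑ S (λ g → ∑ (allMats n) λ M → 𝟙 (matDec M (proj₁ g)) * f M)
      ≡⟨ ∑-swap S (allMats n) _ ⟩
    ∑ (allMats n) (λ M → ∑ S λ g → 𝟙 (matDec M (proj₁ g)) * f M)
      ≡⟨ ∑-cong (allMats n) (λ M → ∑-*ʳ S (f M) _) ⟩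
    ∑ (allMats n) (λ M → ∑ S (λ g → 𝟙 (matDec M (proj₁ g))) * f M)
      ≤⟨ ∑-mono (allMats n) (λ M → *-monoˡ-≤ (f M) (multiplicity M (Invertible? M))) ⟩
    ∑GL n f ∎
    where
    open ≤-Reasoning
    unique-over : ∀ {M g g′} → g ∈ S → g′ ∈ S → M ≡ proj₁ g → M ≡ proj₁ g′ → g ≡ g′
    unique-over {g = g} {g′} g∈ g′∈ eq eq′ = cong₂ _,_ same (dot-ext λ w →
      trans (dot-comm _ w) (trans (intersecting⇒dot≡ (int g∈ g′∈) w (cong (w ᵥ·_) same)) (dot-comm w _)))
      where same = trans (sym eq) eq′
    multiplicity : ∀ M (d : Dec (invertibleᵇ M ≡ true)) → ∑ S (λ g → 𝟙 (matDec M (proj₁ g))) ≤ 𝟙 d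
    multiplicity M (yes _)   = count-≤1 (λ g → matDec M (proj₁ g)) uniq unique-over
    multiplicity M (no ¬inv) = ≤-trans
      (∑-mono-∈ S λ {g} g∈ → ≤-reflexive (𝟙-no (matDec M (proj₁ g)) λ { refl →
        ¬inv (Invertible⇒invertibleᵇ M (All.lookup agl g∈)) }))
      (≤-reflexive (∑-0 S))

  -- The group F₂ⁿ × F₂ⁿ

  infixl 6 _⊞_

  _⊞_ : Vect n × Vect n → Vect n × Vect n → Vect n × Vect n
  (a , x) ⊞ (b , y) = a +ᵥ b , x +ᵥ y

  ⊞-comm : (p q : Vect n × Vect n) → p ⊞ q ≡ q ⊞ p
  ⊞-comm (a , x) (b , y) = cong₂ _,_ (+ᵥ-comm a b) (+ᵥ-comm x y)

  ⊞-assoc : (p q r : Vect n × Vect n) → (p ⊞ q) ⊞ r ≡ p ⊞ (q ⊞ r)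
  ⊞-assoc (a , x) (b , y) (c , z) = cong₂ _,_ (+ᵥ-assoc a b c) (+ᵥ-assoc x y z)

  ∑VV-translate : (p : Vect n × Vect n) (f : Vect n × Vect n → ℕ) → ∑ (VV n) (λ q → f (p ⊞ q)) ≡ ∑ (VV n) f
  ∑VV-translate {n} (a , x) f = begin
    ∑ (VV n) (λ q → f ((a , x) ⊞ q))                       ≡⟨ ∑-cartesianProduct (V n) (V n) _ ⟩
    ∑ (V n) (λ b → ∑ (V n) λ y → f (a +ᵥ b , x +ᵥ y))      ≡⟨ ∑-cong (V n) (λ b → ∑V-translate x (λ y → f (a +ᵥ b , y))) ⟩
    ∑ (V n) (λ b → ∑ (V n) λ y → f (a +ᵥ b , y))           ≡⟨ ∑V-translate a (λ b → ∑ (V n) λ y → f (b , y)) ⟩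
    ∑ (V n) (λ b → ∑ (V n) λ y → f (b , y))                ≡⟨ sym (∑-cartesianProduct (V n) (V n) f) ⟩
    ∑ (VV n) f                                             ∎
    where open ≡-Reasoning

  -- The linearity test draws the points (a , x) and (b , y), whereas GL(n,2) relates the pair (a ,
  -- b) to the pair (x , y); this passes between the two groupings.
  ∑VV-transpose : ∀ n (f : (a b x y : Vect n) → ℕ) →
    ∑ (VV n) (λ (a , x) → ∑ (VV n) λ (b , y) → f a b x y) ≡ ∑ (VV n) (λ (a , b) → ∑ (VV n) λ (x , y) → f a b x y)
  ∑VV-transpose n f = begin
    ∑ (VV n) (λ (a , x) → ∑ (VV n) λ (b , y) → f a b x y)
      ≡⟨ expand f ⟩
    ∑ (V n) (λ a → ∑ (V n) λ x → ∑ (V n) λ b → ∑ (V n) λ y → f a b x y)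
      ≡⟨ ∑-cong (V n) (λ a → ∑-swap (V n) (V n) _) ⟩
    ∑ (V n) (λ a → ∑ (V n) λ b → ∑ (V n) λ x → ∑ (V n) λ y → f a b x y)
      ≡⟨ sym (expand λ a x b y → f a b x y) ⟩
    ∑ (VV n) (λ (a , b) → ∑ (VV n) λ (x , y) → f a b x y) ∎
    where
    open ≡-Reasoning
    expand : ∀ (f : (a b x y : Vect n) → ℕ) → ∑ (VV n) (λ (a , x) → ∑ (VV n) λ (b , y) → f a b x y) ≡
             ∑ (V n) (λ a → ∑ (V n) λ x → ∑ (V n) λ b → ∑ (V n) λ y → f a b x y)
    expand f = trans (∑-cartesianProduct (V n) (V n) _)
      (∑-cong (V n) λ a → ∑-cong (V n) λ x → ∑-cartesianProduct (V n) (V n) _)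

  additive⇒dot₂ : (ψ : Vect n × Vect n → Bool) → (∀ p q → ψ (p ⊞ q) ≡ ψ p xor ψ q) →
                  ∃₂ λ α β → ∀ a x → ψ (a , x) ≡ dot x α xor dot a β
  additive⇒dot₂ {n} ψ add
    with additive⇒dot (λ x → ψ (zeroVec n , x)) (λ x y → trans (cong (λ z → ψ (z , x +ᵥ y)) (sym (+ᵥ-identityˡ _))) (add _ _))
       | additive⇒dot (λ a → ψ (a , zeroVec n)) (λ a b → trans (cong (λ z → ψ (a +ᵥ b , z)) (sym (+ᵥ-identityˡ _))) (add _ _))
  ... | α , ψα | β , ψβ = α , β , λ a x →
    trans (cong ψ (cong₂ _,_ (sym (+ᵥ-identityˡ a)) (sym (+ᵥ-identityʳ x))))
          (trans (add (zeroVec n , x) (a , zeroVec n)) (cong₂ _xor_ (ψα x) (ψβ a)))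

  -- Functions φ (a , x) that are additive on all independent pairs

  open xor-∧-Solver using (solve; _:=_; _:+_)

  xor-shift : ∀ a b c → ((a xor b) xor c) xor c ≡ (a xor c) xor (b xor c)
  xor-shift = solve 3 (λ a b c → ((a :+ b) :+ c) :+ c := (a :+ c) :+ (b :+ c)) refl

  xor-insert : ∀ a b c → a ≡ ((a xor b) xor c) xor (b xor c)
  xor-insert = solve 3 (λ a b c → a := ((a :+ b) :+ c) :+ (b :+ c)) refl

  xor-insertˡ : ∀ a b c → a ≡ ((b xor a) xor c) xor (b xor c)
  xor-insertˡ = solve 3 (λ a b c → a := ((b :+ a) :+ c) :+ (b :+ c)) refl

  xor-collect₁ : ∀ a b c d → (a xor b) xor (c xor d) ≡ a xor ((c xor b) xor d)
  xor-collect₁ = solve 4 (λ a b c d → (a :+ b) :+ (c :+ d) := a :+ ((c :+ b) :+ d)) refl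

  xor-collect₂ : ∀ a b c d → (a xor b) xor ((a xor c) xor d) ≡ b xor (c xor d)
  xor-collect₂ = solve 4 (λ a b c d → (a :+ b) :+ ((a :+ c) :+ d) := b :+ (c :+ d)) refl

  xor-collect₃ : ∀ a b c d → ((a xor c) xor (b xor (c xor d))) xor d ≡ a xor b
  xor-collect₃ = solve 4 (λ a b c d → ((a :+ c) :+ (b :+ (c :+ d))) :+ d := a :+ b) refl

  xor-combine : ∀ a b c d e → ((a xor c) xor e) xor ((b xor d) xor e) ≡ (a xor b) xor (c xor d)
  xor-combine a b c d e = begin
    ((a xor c) xor e) xor ((b xor d) xor e)   ≡⟨ cong (((a xor c) xor e) xor_) (xor-comm (b xor d) e) ⟩
    ((a xor c) xor e) xor (e xor (b xor d))   ≡⟨ xor-cancel-middle (a xor c) e (b xor d) ⟩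
    (a xor c) xor (b xor d)                   ≡⟨ xor-interchange a c b d ⟩
    (a xor b) xor (c xor d)                   ∎
    where open ≡-Reasoning

  -- Adding γ removes the constant, and resetting the value at 0 to `false` makes the corrected
  -- function additive everywhere: in characteristic 2 the dependent pairs then satisfy additivity
  -- trivially.
  affine⇒dot : (r : Vect n → Bool) (γ : Bool) →
               (∀ x y → Independent (x , y) → r (x +ᵥ y) ≡ (r x xor r y) xor γ) →
               ∃ λ α → ∀ x → x ≢ zeroVec n → r x ≡ dot x α xor γ
  affine⇒dot {n} r γ aff = restrict (additive⇒dot ρ ρ-additive)
    where
    ρ : Vect n → Bool
    ρ x with x ≟ᵥ zeroVec n
    ... | yes _ = false
    ... | no _  = r x xor γ
    ρ-zero : ρ (zeroVec n) ≡ false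
    ρ-zero with zeroVec n ≟ᵥ zeroVec n
    ... | yes _  = refl
    ... | no 0≢0 = ⊥-elim (0≢0 refl)
    ρ-nonzero : ∀ x → x ≢ zeroVec n → ρ x ≡ r x xor γ
    ρ-nonzero x x≢0 with x ≟ᵥ zeroVec n
    ... | yes x≡0 = ⊥-elim (x≢0 x≡0)
    ... | no _    = refl
    ρ-additive : ∀ x y → ρ (x +ᵥ y) ≡ ρ x xor ρ y
    ρ-additive x y = case (x ≟ᵥ zeroVec n) (y ≟ᵥ zeroVec n) (y ≟ᵥ x)
      where
      case : Dec (x ≡ zeroVec n) → Dec (y ≡ zeroVec n) → Dec (y ≡ x) → ρ (x +ᵥ y) ≡ ρ x xor ρ y
      case (yes refl) _ _ = trans (cong ρ (+ᵥ-identityˡ y)) (cong (_xor ρ y) (sym ρ-zero))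
      case (no _) (yes refl) _ = trans (cong ρ (+ᵥ-identityʳ x))
        (trans (sym (xor-identityʳ _)) (cong (ρ x xor_) (sym ρ-zero)))
      case (no _) (no _) (yes refl) = trans (cong ρ (+ᵥ-same x)) (trans ρ-zero (sym (xor-same (ρ x))))
      case (no x≢0) (no y≢0) (no y≢x) = begin
        ρ (x +ᵥ y)                       ≡⟨ ρ-nonzero (x +ᵥ y) (y≢x ∘ sym ∘ +ᵥ≡0⇒≡ x y) ⟩
        r (x +ᵥ y) xor γ                 ≡⟨ cong (_xor γ) (aff x y (x≢0 , y≢0 , y≢x)) ⟩
        ((r x xor r y) xor γ) xor γ      ≡⟨ xor-shift (r x) (r y) γ ⟩
        (r x xor γ) xor (r y xor γ)      ≡⟨ sym (cong₂ _xor_ (ρ-nonzero x x≢0) (ρ-nonzero y y≢0)) ⟩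
        ρ x xor ρ y                      ∎
        where open ≡-Reasoning
    restrict : (∃ λ α → ∀ x → ρ x ≡ dot x α) → ∃ λ α → ∀ x → x ≢ zeroVec n → r x ≡ dot x α xor γ
    restrict (α , ρα) = α , λ x x≢0 → trans (sym (xor-cancelʳ (r x) γ))
      (cong (_xor γ) (trans (sym (ρ-nonzero x x≢0)) (ρα x)))

  -- Swapping a and b does not change the sum of the two points, and this splits φ into a function
  -- of x plus a function of a. Each part is then affine, and the constants cancel. Dimension at
  -- least 2 supplies an independent pair to hold fixed in one variable.
  bilocal⇒dot : ∀ {k} → let d = suc (suc k) in (φ : Vect d × Vect d → Bool) →
    (∀ a b x y → Independent (a , b) → Independent (x , y) → φ ((a , x) ⊞ (b , y)) ≡ φ (a , x) xor φ (b , y)) →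
    ∃₂ λ α β → ∀ a x → a ≢ zeroVec d → x ≢ zeroVec d → φ (a , x) ≡ dot x α xor dot a β
  bilocal⇒dot {k} φ loc = combine (affine⇒dot r γ r-affine) (affine⇒dot s (γ xor t) s-affine)
    where
    d : ℕ
    d = suc (suc k)
    e₁ e₂ : Vect d
    e₁ = true ∷ false ∷ zeroVec k
    e₂ = false ∷ true ∷ zeroVec k
    e₁≢0 : e₁ ≢ zeroVec d
    e₁≢0 ()
    indep : Independent (e₁ , e₂)
    indep = (λ ()) , (λ ()) , λ ()
    t : Bool
    t = φ (e₁ , e₁)
    r s : Vect d → Bool
    r x = φ (e₁ , x)
    s a = φ (a , e₁)

    -- For independent pairs both sides are the value of φ at the same point (a + b , x + y); when a
    -- = b or x = y the identity is trivial.
    exchange : ∀ a b x y → a ≢ zeroVec d → b ≢ zeroVec d → x ≢ zeroVec d → y ≢ zeroVec d →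
               φ (a , x) xor φ (b , y) ≡ φ (b , x) xor φ (a , y)
    exchange a b x y a≢0 b≢0 x≢0 y≢0 with b ≟ᵥ a | y ≟ᵥ x
    ... | yes refl | _        = refl
    ... | no b≢a   | yes refl = xor-comm (φ (a , x)) (φ (b , x))
    ... | no b≢a   | no y≢x   = begin
      φ (a , x) xor φ (b , y)    ≡⟨ sym (loc a b x y (a≢0 , b≢0 , b≢a) (x≢0 , y≢0 , y≢x)) ⟩
      φ (a +ᵥ b , x +ᵥ y)        ≡⟨ cong (λ c → φ (c , x +ᵥ y)) (+ᵥ-comm a b) ⟩
      φ (b +ᵥ a , x +ᵥ y)        ≡⟨ loc b a x y (b≢0 , a≢0 , b≢a ∘ sym) (x≢0 , y≢0 , y≢x) ⟩
      φ (b , x) xor φ (a , y)    ∎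
      where open ≡-Reasoning

    split : ∀ a x → a ≢ zeroVec d → x ≢ zeroVec d → φ (a , x) ≡ (r x xor s a) xor t
    split a x a≢0 x≢0 = trans (sym (xor-cancelʳ (φ (a , x)) t)) (cong (_xor t) (exchange a e₁ x e₁ a≢0 e₁≢0 x≢0 e₁≢0))

    -- With φ split, locality at (a , b) and (x , y) separates the variables.
    separated : ∀ a b x y → Independent (a , b) → Independent (x , y) →
      (r (x +ᵥ y) xor s (a +ᵥ b)) xor t ≡ ((r x xor s a) xor t) xor ((r y xor s b) xor t)
    separated a b x y ab@(a≢0 , b≢0 , b≢a) xy@(x≢0 , y≢0 , y≢x) = begin
      (r (x +ᵥ y) xor s (a +ᵥ b)) xor t
        ≡⟨ sym (split (a +ᵥ b) (x +ᵥ y) (b≢a ∘ sym ∘ +ᵥ≡0⇒≡ a b) (y≢x ∘ sym ∘ +ᵥ≡0⇒≡ x y)) ⟩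
      φ (a +ᵥ b , x +ᵥ y)
        ≡⟨ loc a b x y ab xy ⟩
      φ (a , x) xor φ (b , y)
        ≡⟨ cong₂ _xor_ (split a x a≢0 x≢0) (split b y b≢0 y≢0) ⟩
      ((r x xor s a) xor t) xor ((r y xor s b) xor t) ∎
      where open ≡-Reasoning

    -- The constant left over when (a , b) is frozen at (`e₁` , `e₂`) in `separated`.
    γ : Bool
    γ = (s (e₁ +ᵥ e₂) xor (s e₁ xor s e₂)) xor t

    r-affine : ∀ x y → Independent (x , y) → r (x +ᵥ y) ≡ (r x xor r y) xor γ
    r-affine x y xy = begin
      r (x +ᵥ y)
        ≡⟨ xor-insert (r (x +ᵥ y)) (s (e₁ +ᵥ e₂)) t ⟩
      ((r (x +ᵥ y) xor s (e₁ +ᵥ e₂)) xor t) xor (s (e₁ +ᵥ e₂) xor t)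
        ≡⟨ cong (_xor (s (e₁ +ᵥ e₂) xor t)) (separated e₁ e₂ x y indep xy) ⟩
      (((r x xor s e₁) xor t) xor ((r y xor s e₂) xor t)) xor (s (e₁ +ᵥ e₂) xor t)
        ≡⟨ cong (_xor (s (e₁ +ᵥ e₂) xor t)) (xor-combine (r x) (r y) (s e₁) (s e₂) t) ⟩
      ((r x xor r y) xor (s e₁ xor s e₂)) xor (s (e₁ +ᵥ e₂) xor t)
        ≡⟨ xor-collect₁                (r x xor r y) (s e₁ xor s e₂) (s (e₁ +ᵥ e₂)) t ⟩
      (r x xor r y) xor γ ∎
      where open ≡-Reasoning

    -- Freezing (x , y) instead and inserting `r-affine` expresses the second constant through γ, so
    -- that γ and t both cancel in `combine`.
    s-affine : ∀ a b → Independent (a , b) → s (a +ᵥ b) ≡ (s a xor s b) xor (γ xor t)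
    s-affine a b ab = begin
      s (a +ᵥ b)
        ≡⟨ xor-insertˡ (s (a +ᵥ b)) (r (e₁ +ᵥ e₂)) t ⟩
      ((r (e₁ +ᵥ e₂) xor s (a +ᵥ b)) xor t) xor (r (e₁ +ᵥ e₂) xor t)
        ≡⟨ cong₂ (λ z w → z xor (w xor t)) (separated a b e₁ e₂ ab indep) (r-affine e₁ e₂ indep) ⟩
      (((r e₁ xor s a) xor t) xor ((r e₂ xor s b) xor t)) xor (((r e₁ xor r e₂) xor γ) xor t)
        ≡⟨ cong (_xor (((r e₁ xor r e₂) xor γ) xor t)) (xor-combine (r e₁) (r e₂) (s a) (s b) t) ⟩
      ((r e₁ xor r e₂) xor (s a xor s b)) xor (((r e₁ xor r e₂) xor γ) xor t)
        ≡⟨ xor-collect₂                (r e₁ xor r e₂) (s a xor s b) γ t ⟩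
      (s a xor s b) xor (γ xor t) ∎
      where open ≡-Reasoning

    combine : (∃ λ α → ∀ x → x ≢ zeroVec d → r x ≡ dot x α xor γ) →
              (∃ λ β → ∀ a → a ≢ zeroVec d → s a ≡ dot a β xor (γ xor t)) →
              ∃₂ λ α β → ∀ a x → a ≢ zeroVec d → x ≢ zeroVec d → φ (a , x) ≡ dot x α xor dot a β
    combine (α , rα) (β , sβ) = α , β , λ a x a≢0 x≢0 → begin
      φ (a , x)
        ≡⟨ split a x a≢0 x≢0 ⟩
      (r x xor s a) xor t
        ≡⟨ cong₂ (λ z w → (z xor w) xor t) (rα x x≢0) (sβ a a≢0) ⟩
      ((dot x α xor γ) xor (dot a β xor (γ xor t))) xor t
        ≡⟨ xor-collect₃ (dot x α) (dot a β) γ t ⟩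
      dot x α xor dot a β ∎
      where open ≡-Reasoning

  -- The function φ of an intersecting set and its local equations

  module Family {n} (S : List (Aff n)) (uniq : Unique S) (agl : All IsAGL S) (int : IntersectingSet S)
    where

    φ? : (p : Vect n × Vect n) → Dec (Any (λ g → proj₂ p ≡ proj₁ p ᵥ· proj₁ g × dot (proj₁ p) (proj₂ g) ≡ true) S)
    φ? (a , x) = Any.any? (λ g → (x ≟ᵥ a ᵥ· proj₁ g) ×-dec (dot a (proj₂ g) Bool.≟ true)) S

    -- φ (a , x) is the common value of a · v over the (M , v) ∈ S with a M = x
    -- (and false if there are none).
    φ : Vect n × Vect n → Bool
    φ p = does (φ? p)

    -- Well-definedness of φ: any other member of S witnessing the value `true` over the same (a ,
    -- x) must agree with g, by `intersecting⇒dot≡`.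
    φ-value : ∀ {g} → g ∈ S → ∀ a → φ (a , a ᵥ· proj₁ g) ≡ dot a (proj₂ g)
    φ-value {g} g∈ a = case (dot a (proj₂ g)) refl
      where
      case : ∀ b → dot a (proj₂ g) ≡ b → φ (a , a ᵥ· proj₁ g) ≡ b
      case true  eq = dec-true (φ? (a , a ᵥ· proj₁ g)) (lose g∈ (refl , eq))
      case false eq = dec-false (φ? (a , a ᵥ· proj₁ g)) λ found → absurd (find found)
        where
        absurd : (∃ λ g′ → g′ ∈ S × (a ᵥ· proj₁ g ≡ a ᵥ· proj₁ g′ × dot a (proj₂ g′) ≡ true)) → ⊥
        absurd (g′ , g′∈ , aM≡ , av′) =
          true≢false (trans (sym av′) (trans (sym (intersecting⇒dot≡ (int g∈ g′∈) a aM≡)) eq))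

    open LinearityTest _⊞_ (VV n) ∑VV-translate ⊞-comm ⊞-assoc φ public

    φ-local : ∀ {g} → g ∈ S → ∀ a b x y → x ≡ a ᵥ· proj₁ g → y ≡ b ᵥ· proj₁ g →
              φ ((a , x) ⊞ (b , y)) ≡ φ (a , x) xor φ (b , y)
    φ-local {M , v} g∈ a b x y refl refl = begin
      φ (a +ᵥ b , a ᵥ· M +ᵥ b ᵥ· M)         ≡⟨ cong (λ z → φ (a +ᵥ b , z)) (sym (ᵥ·-+ a b M)) ⟩
      φ (a +ᵥ b , (a +ᵥ b) ᵥ· M)            ≡⟨ φ-value g∈ (a +ᵥ b) ⟩
      dot (a +ᵥ b) v                        ≡⟨ dot-+ˡ a b v ⟩
      dot a v xor dot b v                   ≡⟨ sym (cong₂ _xor_ (φ-value g∈ a) (φ-value g∈ b)) ⟩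
      φ (a , a ᵥ· M) xor φ (b , b ᵥ· M)     ∎
      where open ≡-Reasoning

    fails₂? : (ab xy : Vect n × Vect n) → let (a , b) = ab; (x , y) = xy in
              Dec (φ ((a , x) ⊞ (b , y)) ≢ φ (a , x) xor φ (b , y))
    fails₂? (a , b) (x , y) = fails? (a , x) (b , y)

    occurrences : Vect n × Vect n → Vect n × Vect n → ℕ
    occurrences (a , b) (x , y) = ∑ S λ g → 𝟙 (x ≟ᵥ a ᵥ· proj₁ g) * 𝟙 (y ≟ᵥ b ᵥ· proj₁ g)

    occurrences≤fibre₂ : ∀ ab xy → occurrences ab xy ≤ fibre₂ ab xy
    occurrences≤fibre₂ (a , b) (x , y) = ∑≤∑GL uniq agl int λ M → 𝟙 (x ≟ᵥ a ᵥ· M) * 𝟙 (y ≟ᵥ b ᵥ· M)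

    -- A dichotomy: a single member of S carrying a to x and b to y already forces the equation, so
    -- where the equation fails S misses the entire fibre.
    fails+occurrences : ∀ ab xy → 𝟙 (fails₂? ab xy) * fibre₂ ab xy + occurrences ab xy ≤ fibre₂ ab xy
    fails+occurrences ab@(a , b) xy@(x , y) = case (fails₂? ab xy)
      where
      open ≤-Reasoning
      case : (d : Dec (φ ((a , x) ⊞ (b , y)) ≢ φ (a , x) xor φ (b , y))) →
             𝟙 d * fibre₂ ab xy + occurrences ab xy ≤ fibre₂ ab xy
      case (no _)      = occurrences≤fibre₂ ab xy
      case (yes fails) = begin
        1 * fibre₂ ab xy + occurrences ab xy
          ≤⟨ +-monoʳ-≤ (1 * fibre₂ ab xy) (∑-mono-∈ S λ {g} g∈ → none g∈ (x ≟ᵥ a ᵥ· proj₁ g) (y ≟ᵥ b ᵥ· proj₁ g)) ⟩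
        1 * fibre₂ ab xy + ∑ S (λ _ → 0)
          ≡⟨ trans (cong (1 * fibre₂ ab xy +_) (∑-0 S)) (trans (+-identityʳ _) (*-identityˡ _)) ⟩
        fibre₂ ab xy ∎
        where
        none : ∀ {g} → g ∈ S → (d : Dec (x ≡ a ᵥ· proj₁ g)) (e : Dec (y ≡ b ᵥ· proj₁ g)) → 𝟙 d * 𝟙 e ≤ 0
        none g∈ (yes eq) (yes eq′) = ⊥-elim (fails (φ-local g∈ a b x y eq eq′))
        none g∈ (yes _)  (no _)    = z≤n
        none g∈ (no _)   e         = z≤n

    localDefect : Vect n × Vect n → ℕ
    localDefect ab = ∑ (VV n) λ xy → 𝟙 (Independent? xy) * 𝟙 (fails₂? ab xy)

    length≤∑occurrences : ∀ ab → Independent ab → length S ≤ ∑ (VV n) λ xy → 𝟙 (Independent? xy) * occurrences ab xy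
    length≤∑occurrences ab@(a , b) ind = begin
      length S
        ≡⟨ sym (∑-length S) ⟩
      ∑ S (λ _ → 1)
        ≤⟨ ∑-mono-∈ S (λ {g} g∈ → ≤-reflexive (sym (𝟙-yes (Independent? (a ᵥ· proj₁ g , b ᵥ· proj₁ g))
             (ᵥ·-Independent (proj₁ g) (All.lookup agl g∈) ind)))) ⟩
      ∑ S (λ g → 𝟙 (Independent? (a ᵥ· proj₁ g , b ᵥ· proj₁ g)))
        ≡⟨ ∑-cong S (λ g → sym (trans (∑-cong (VV n) λ xy → *-comm (𝟙 (Independent? xy)) _)
             (∑VV-enumerates (a ᵥ· proj₁ g) (b ᵥ· proj₁ g) λ xy → 𝟙 (Independent? xy)))) ⟩
      ∑ S (λ g → ∑ (VV n) λ xy@(x , y) → 𝟙 (Independent? xy) * (𝟙 (x ≟ᵥ a ᵥ· proj₁ g) * 𝟙 (y ≟ᵥ b ᵥ· proj₁ g)))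
        ≡⟨ ∑-swap S (VV n) _ ⟩
      ∑ (VV n) (λ xy@(x , y) → ∑ S λ g → 𝟙 (Independent? xy) * (𝟙 (x ≟ᵥ a ᵥ· proj₁ g) * 𝟙 (y ≟ᵥ b ᵥ· proj₁ g)))
        ≡⟨ ∑-cong (VV n) (λ xy → ∑-*ˡ S (𝟙 (Independent? xy)) _) ⟩
      ∑ (VV n) (λ xy → 𝟙 (Independent? xy) * occurrences ab xy) ∎
      where open ≤-Reasoning

    -- All fibres over independent (x , y) have `glOrder n` / `frames n` matrices, each failing one
    -- contains nothing of S, and together they make up the group. Multiplying by `frames n` clears
    -- the division.
    localDefect-bound : ∀ ab → Independent ab →
                        localDefect ab * glOrder n + frames n * length S ≤ frames n * glOrder n
    localDefect-bound ab ind = begin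
      localDefect ab * glOrder n + frames n * length S
        ≤⟨ +-mono-≤ (≤-reflexive defect≡) (*-monoʳ-≤ (frames n) (length≤∑occurrences ab ind)) ⟩
      frames n * ∑ (VV n) (λ xy → 𝟙 (Independent? xy) * (𝟙 (fails₂? ab xy) * fibre₂ ab xy))
        + frames n * ∑ (VV n) (λ xy → 𝟙 (Independent? xy) * occurrences ab xy)
        ≡⟨ sym (*-distribˡ-+ (frames n) _ _) ⟩
      frames n * (∑ (VV n) (λ xy → 𝟙 (Independent? xy) * (𝟙 (fails₂? ab xy) * fibre₂ ab xy))
        + ∑ (VV n) (λ xy → 𝟙 (Independent? xy) * occurrences ab xy))
        ≡⟨ cong (frames n *_) (trans (sym (∑-+ (VV n) _ _)) (∑-cong (VV n) λ xy → sym (*-distribˡ-+ (𝟙 (Independent? xy)) _ _))) ⟩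
      frames n * ∑ (VV n) (λ xy → 𝟙 (Independent? xy) * (𝟙 (fails₂? ab xy) * fibre₂ ab xy + occurrences ab xy))
        ≤⟨ *-monoʳ-≤ (frames n) (∑-mono (VV n) λ xy → *-monoʳ-≤ (𝟙 (Independent? xy)) (fails+occurrences ab xy)) ⟩
      frames n * ∑ (VV n) (λ xy → 𝟙 (Independent? xy) * fibre₂ ab xy)
        ≡⟨ cong (frames n *_) (∑fibre₂ ab ind) ⟩
      frames n * glOrder n ∎
      where
      open ≤-Reasoning
      rearrange : ∀ f i e k → f * (i * (e * k)) ≡ i * e * (f * k)
      rearrange = solve-∀
      term : ∀ xy (d : Dec (Independent xy)) e → 𝟙 d * e * glOrder n ≡ frames n * (𝟙 d * (e * fibre₂ ab xy))
      term xy (yes ind′) e = trans (cong (1 * e *_) (sym (frames*fibre₂ ab xy ind ind′)))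
                                   (sym (rearrange (frames n) 1 e (fibre₂ ab xy)))
      term xy (no _)     e = sym (*-zeroʳ (frames n))
      defect≡ : localDefect ab * glOrder n ≡
                frames n * ∑ (VV n) (λ xy → 𝟙 (Independent? xy) * (𝟙 (fails₂? ab xy) * fibre₂ ab xy))
      defect≡ = trans (sym (∑-*ʳ (VV n) (glOrder n) _))
        (trans (∑-cong (VV n) λ xy → term xy (Independent? xy) (𝟙 (fails₂? ab xy))) (∑-*ˡ (VV n) (frames n) _))

    length≤glOrder : length S ≤ glOrder n
    length≤glOrder = begin
      length S          ≡⟨ sym (∑-length S) ⟩
      ∑ S (λ _ → 1)     ≤⟨ ∑≤∑GL uniq agl int (λ _ → 1) ⟩
      ∑GL n (λ _ → 1)   ≡⟨ sym (glOrder≡∑GL n) ⟩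
      glOrder n         ∎
      where open ≤-Reasoning

    -- R is the deficit of S, and 1/K bounds it relative to the group. The same K bounds the
    -- proportion of failing equations.
    module _ (K R : ℕ) (S+R : length S + R ≡ glOrder n) (KR≤ : K * R ≤ glOrder n) where

      K*localDefect≤frames : ∀ ab → Independent ab → K * localDefect ab ≤ frames n
      K*localDefect≤frames ab ind = *-cancelʳ-≤ _ _ (glOrder n) {{>-nonZero (glOrder>0 n)}} (begin
        K * localDefect ab * glOrder n     ≡⟨ *-assoc K _ _ ⟩
        K * (localDefect ab * glOrder n)   ≤⟨ *-monoʳ-≤ K (+-cancelʳ-≤ (frames n * length S) _ _ step) ⟩
        K * (frames n * R)                 ≡⟨ exchange K (frames n) R ⟩
        frames n * (K * R)                 ≤⟨ *-monoʳ-≤ (frames n) KR≤ ⟩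
        frames n * glOrder n               ∎)
        where
        open ≤-Reasoning
        exchange : ∀ a b c → a * (b * c) ≡ b * (a * c)
        exchange = solve-∀
        step : localDefect ab * glOrder n + frames n * length S ≤ frames n * R + frames n * length S
        step = begin
          localDefect ab * glOrder n + frames n * length S   ≤⟨ localDefect-bound ab ind ⟩
          frames n * glOrder n                               ≡⟨ cong (frames n *_) (sym S+R) ⟩
          frames n * (length S + R)                          ≡⟨ *-distribˡ-+ (frames n) (length S) R ⟩
          frames n * length S + frames n * R                 ≡⟨ +-comm (frames n * length S) _ ⟩
          frames n * R + frames n * length S                 ∎

      -- A single failure would make `localDefect` at least 1, and then K could not exceed the
      -- number of frames.
      φ-bilocal : frames n < K → ∀ a b x y → Independent (a , b) → Independent (x , y) →
                  φ ((a , x) ⊞ (b , y)) ≡ φ (a , x) xor φ (b , y)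
      φ-bilocal frames<K a b x y ab xy = ≢?-stable λ fails → <-irrefl refl (begin-strict
        frames n                   <⟨ frames<K ⟩
        K                          ≡⟨ sym (*-identityʳ K) ⟩
        K * 1                      ≡⟨ cong (K *_) (sym (cong₂ _*_ (𝟙-yes (Independent? (x , y)) xy) (𝟙-yes (fails₂? (a , b) (x , y)) fails))) ⟩
        K * (𝟙 (Independent? (x , y)) * 𝟙 (fails₂? (a , b) (x , y)))
                                   ≤⟨ *-monoʳ-≤ K (∑VV-single (x , y)) ⟩
        K * localDefect (a , b)    ≤⟨ K*localDefect≤frames (a , b) ab ⟩
        frames n                   ∎)
        where
        open ≤-Reasoning
        ∑VV-single : ∀ xy → 𝟙 (Independent? xy) * 𝟙 (fails₂? (a , b) xy) ≤ localDefect (a , b)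
        ∑VV-single xy@(x , y) = begin
          𝟙 (Independent? xy) * 𝟙 (fails₂? (a , b) xy)
            ≡⟨ sym (∑VV-enumerates x y λ xy → 𝟙 (Independent? xy) * 𝟙 (fails₂? (a , b) xy)) ⟩
          ∑ (VV n) (λ (x′ , y′) → 𝟙 (x′ ≟ᵥ x) * 𝟙 (y′ ≟ᵥ y) * (𝟙 (Independent? (x′ , y′)) * 𝟙 (fails₂? (a , b) (x′ , y′))))
            ≤⟨ ∑-mono (VV n) (λ (x′ , y′) → ≤-trans (*-monoˡ-≤ (𝟙 (Independent? (x′ , y′)) * 𝟙 (fails₂? (a , b) (x′ , y′)))
                 (*-mono-≤ (𝟙≤1 (x′ ≟ᵥ x)) (𝟙≤1 (y′ ≟ᵥ y)))) (≤-reflexive (*-identityˡ _))) ⟩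
          localDefect (a , b) ∎

    -- Testing v + M α against a gives a · v + (a M) · α, and a · v is φ at (a , a M); the formula
    -- for φ leaves a · β. The row a = 0 is handled apart because the exact case knows φ only at
    -- nonzero vectors.
    canonical⇒ : ∀ α β → (∀ {g} → g ∈ S → ∀ a → a ≢ zeroVec n →
                            φ (a , a ᵥ· proj₁ g) ≡ dot (a ᵥ· proj₁ g) α xor dot a β) →
                 All (λ g → act g α ≡ β) S
    canonical⇒ α β h = All.tabulate λ {g} g∈ → dot-ext λ a → lemma g∈ a (a ≟ᵥ zeroVec n)
      where
      open ≡-Reasoning
      lemma : ∀ {g} → g ∈ S → ∀ a → Dec (a ≡ zeroVec n) → dot (act g α) a ≡ dot β a
      lemma {g} g∈ a (yes refl) = trans (dot-zeroʳ (act g α)) (sym (dot-zeroʳ β))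
      lemma {M , v} g∈ a (no a≢0) = begin
        dot (v +ᵥ (M ·ᵥ α)) a              ≡⟨ dot-comm (v +ᵥ (M ·ᵥ α)) a ⟩
        dot a (v +ᵥ (M ·ᵥ α))              ≡⟨ dot-+ʳ a v _ ⟩
        dot a v xor dot a (M ·ᵥ α)         ≡⟨ cong₂ _xor_ (trans (sym (φ-value g∈ a)) (h g∈ a a≢0)) (sym (dot-ᵥ· a M α)) ⟩
        (dot (a ᵥ· M) α xor dot a β) xor dot (a ᵥ· M) α
                                           ≡⟨ trans (cong (_xor dot (a ᵥ· M) α) (xor-comm (dot (a ᵥ· M) α) _)) (xor-cancelʳ (dot a β) _) ⟩
        dot a β                            ≡⟨ dot-comm a β ⟩
        dot β a                            ∎

    -- Quadruples with (a , b) or (x , y) dependent are counted as failing outright; only the others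
    -- are controlled by S.
    defect-split : defect ≤ dependents n * order + order * dependents n + ∑ (VV n) λ ab → 𝟙 (Independent? ab) * localDefect ab
    defect-split = begin
      defect
        ≡⟨ ∑VV-transpose n (λ a b x y → 𝟙 (fails? (a , x) (b , y))) ⟩
      ∑ (VV n) (λ ab → ∑ (VV n) λ xy → 𝟙 (fails₂? ab xy))
        ≤⟨ ∑-mono (VV n) (λ ab → ∑-mono (VV n) λ xy →
             split (Independent? ab) (Independent? xy) (fails₂? ab xy)) ⟩
      ∑ (VV n) (λ ab → ∑ (VV n) λ xy → 𝟙 (¬? (Independent? ab)) * 1 + 1 * 𝟙 (¬? (Independent? xy))
                                         + 𝟙 (Independent? ab) * (𝟙 (Independent? xy) * 𝟙 (fails₂? ab xy)))
        ≡⟨ ∑-cong (VV n) (λ ab → trans (∑-+ (VV n) _ _) (cong₂ _+_ (∑-+ (VV n) _ _) (∑-*ˡ (VV n) (𝟙 (Independent? ab)) _))) ⟩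
      ∑ (VV n) (λ ab → ∑ (VV n) (λ xy → 𝟙 (¬? (Independent? ab)) * 1) + ∑ (VV n) (λ xy → 1 * 𝟙 (¬? (Independent? xy)))
                        + 𝟙 (Independent? ab) * localDefect ab)
        ≡⟨ trans (∑-+ (VV n) _ _) (cong (_+ ∑ (VV n) λ ab → 𝟙 (Independent? ab) * localDefect ab)
             (trans (∑-+ (VV n) _ _) (cong₂ _+_ (∑-product (VV n) (VV n) (λ ab → 𝟙 (¬? (Independent? ab))) (λ _ → 1))
                                                (∑-product (VV n) (VV n) (λ _ → 1) (λ xy → 𝟙 (¬? (Independent? xy))))))) ⟩
      dependents n * order + order * dependents n + ∑ (VV n) (λ ab → 𝟙 (Independent? ab) * localDefect ab) ∎
      where
      open ≤-Reasoning
      split : {P Q F : Set} (d : Dec P) (e : Dec Q) (f : Dec F) →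
              𝟙 f ≤ 𝟙 (¬? d) * 1 + 1 * 𝟙 (¬? e) + 𝟙 d * (𝟙 e * 𝟙 f)
      split (no _)  (yes _) f = ≤-trans (𝟙≤1 f) (s≤s z≤n)
      split (no _)  (no _)  f = ≤-trans (𝟙≤1 f) (s≤s z≤n)
      split (yes _) (no _)  f = ≤-trans (𝟙≤1 f) (s≤s z≤n)
      split (yes _) (yes _) f = ≤-reflexive (sym (trans (*-identityˡ _) (*-identityˡ _)))

  -- Matrices that agree with a given one on some row: second moments

  -- Bonferroni's inequality [X > 0] ≥ X − C(X,2), doubled and written for [X = 0].
  bonferroni : ∀ k → 3 * k + 2 * 𝟙 (k ≟ 0) ≤ 2 + k * k
  bonferroni 0 = ≤-refl
  bonferroni 1 = ≤-refl
  bonferroni 2 = ≤-refl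
  bonferroni (suc (suc (suc k))) = ≤-trans (m≤m+n _ (k * k + 3 * k + 2)) (≤-reflexive (identity′ k))
    where
    identity′ : ∀ k → 3 * (3 + k) + 0 + (k * k + 3 * k + 2) ≡ 2 + (3 + k) * (3 + k)
    identity′ = solve-∀

  -- Here N = 2ⁿ - 1, F counts frames, h = 2ⁿ⁻¹, g is the group order, X and Y are the first two
  -- moments of `agreement`, and Z is `disjoint`. As n grows, X/g tends to 1/2 and the bound on Y/g
  -- to 3/4, so Bonferroni yields 1 - 3/4 + 3/8 = 5/8. Writing everything in terms of i makes the
  -- comparison polynomial.
  moment-arithmetic : ∀ i {N F h g X Y Z} .{{_ : NonZero i}} → N ≡ suc (2 * i) → F ≡ N * (2 * i) → h ≡ suc i →
    N * X ≡ h * g → F * Y + h * g ≤ h * (2 * i * g) + h * h * g → 3 * X + 2 * Z ≤ 2 * g + Y →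
    8 * Z + 3 * g ≤ 8 * g
  moment-arithmetic i@(suc _) {g = g} {X} {Y} {Z} refl refl refl first second third =
    *-cancelˡ-≤ (i * N) (+-cancelʳ-≤ rest _ _ (begin
      i * N * (8 * Z + 3 * g) + rest
        ≤⟨ m≤n+m _ (3 * i * g) ⟩
      3 * i * g + (i * N * (8 * Z + 3 * g) + rest)
        ≡⟨ regroup₁ i g Z ⟩
      2 * (3 * (2 * i) * (suc i * g) + F * (2 * Z) + suc i * g)
        ≡⟨ cong (λ t → 2 * (3 * (2 * i) * t + F * (2 * Z) + suc i * g)) (sym first) ⟩
      2 * (3 * (2 * i) * (N * X) + F * (2 * Z) + suc i * g)
        ≡⟨ regroup₂ i g X Z ⟩
      2 * (F * (3 * X + 2 * Z) + suc i * g)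
        ≤⟨ *-monoʳ-≤ 2 (+-monoˡ-≤ (suc i * g) (*-monoʳ-≤ F third)) ⟩
      2 * (F * (2 * g + Y) + suc i * g)
        ≡⟨ regroup₃ i g Y ⟩
      2 * (F * (2 * g) + (F * Y + suc i * g))
        ≤⟨ *-monoʳ-≤ 2 (+-monoʳ-≤ (F * (2 * g)) second) ⟩
      2 * (F * (2 * g) + (suc i * (2 * i * g) + suc i * suc i * g))
        ≡⟨ regroup₄ i g ⟩
      i * N * (8 * g) + rest ∎))
    where
    open ≤-Reasoning
    N = suc (2 * i)
    F = N * (2 * i)
    -- The terms that a calculation with subtraction would move across; they are added to both sides
    -- and cancelled at the end. The dropped summand 3 i g is the gap to the limit 5/8.
    rest = 6 * (i * suc i * g) + 2 * (suc i * g)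
    regroup₁ : ∀ i g Z →
      3 * i * g + (i * suc (2 * i) * (8 * Z + 3 * g) + (6 * (i * suc i * g) + 2 * (suc i * g))) ≡
      2 * (3 * (2 * i) * (suc i * g) + suc (2 * i) * (2 * i) * (2 * Z) + suc i * g)
    regroup₁ = solve-∀
    regroup₂ : ∀ i g X Z →
      2 * (3 * (2 * i) * (suc (2 * i) * X) + suc (2 * i) * (2 * i) * (2 * Z) + suc i * g) ≡
      2 * (suc (2 * i) * (2 * i) * (3 * X + 2 * Z) + suc i * g)
    regroup₂ = solve-∀
    regroup₃ : ∀ i g Y →
      2 * (suc (2 * i) * (2 * i) * (2 * g + Y) + suc i * g) ≡
      2 * (suc (2 * i) * (2 * i) * (2 * g) + (suc (2 * i) * (2 * i) * Y + suc i * g))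
    regroup₃ = solve-∀
    regroup₄ : ∀ i g →
      2 * (suc (2 * i) * (2 * i) * (2 * g) + (suc i * (2 * i * g) + suc i * suc i * g)) ≡
      i * suc (2 * i) * (8 * g) + (6 * (i * suc i * g) + 2 * (suc i * g))
    regroup₄ = solve-∀

  module Agreement {n} (M₀ : Mat n) (inv₀ : Invertible M₀) (w : Vect n) (w≢0 : w ≢ zeroVec n) where

    χ : Vect n → Mat n → ℕ
    χ a M = 𝟙 (dot a w Bool.≟ true) * 𝟙 (a ᵥ· M₀ ≟ᵥ a ᵥ· M)

    agreement : Mat n → ℕ
    agreement M = ∑ (V n) λ a → χ a M

    -- With w the error of an element over `M₀`, these are the only matrices over which an
    -- error-free member of the same family can lie.
    disjoint : ℕ
    disjoint = ∑GL n λ M → 𝟙 (agreement M ≟ 0)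

    h : ℕ
    h = ∑ (V n) λ a → 𝟙 (dot a w Bool.≟ true)

    -- Each of the h rows a with a · w = 1 is nonzero and so contributes one fibre of the action on
    -- nonzero vectors.
    first-moment : nonzeros n * ∑GL n agreement ≡ h * glOrder n
    first-moment = begin
      nonzeros n * ∑GL n agreement
        ≡⟨ cong (nonzeros n *_) (∑GL-∑ n (V n) _) ⟩
      nonzeros n * ∑ (V n) (λ a → ∑GL n (χ a))
        ≡⟨ sym (∑-*ˡ (V n) (nonzeros n) _) ⟩
      ∑ (V n) (λ a → nonzeros n * ∑GL n (χ a))
        ≡⟨ ∑-cong (V n) (λ a → term a (dot a w Bool.≟ true)) ⟩
      ∑ (V n) (λ a → 𝟙 (dot a w Bool.≟ true) * glOrder n)
        ≡⟨ ∑-*ʳ (V n) (glOrder n) _ ⟩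
      h * glOrder n ∎
      where
      open ≡-Reasoning
      term : ∀ a (d : Dec (dot a w ≡ true)) →
             nonzeros n * ∑GL n (λ M → 𝟙 d * 𝟙 (a ᵥ· M₀ ≟ᵥ a ᵥ· M)) ≡ 𝟙 d * glOrder n
      term a (no _)   = trans (cong (nonzeros n *_) (∑GL-*ˡ n 0 λ M → 𝟙 (a ᵥ· M₀ ≟ᵥ a ᵥ· M))) (*-zeroʳ (nonzeros n))
      term a (yes aw) = trans (cong (nonzeros n *_) (trans (∑GL-*ˡ n 1 λ M → 𝟙 (a ᵥ· M₀ ≟ᵥ a ᵥ· M)) (*-identityˡ _)))
        (trans (nonzeros*fibre₁ a (a ᵥ· M₀) a≢0 (ᵥ·-nonzero M₀ inv₀ a≢0)) (sym (*-identityˡ _)))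
        where a≢0 = dot≡true⇒≢0 a w aw

    module _ (k : ℕ) (N≡ : nonzeros n ≡ suc k) where

      frames≡ : frames n ≡ nonzeros n * k
      frames≡ = +-cancelʳ-≡ (nonzeros n) _ _ (trans (frames+nonzeros n)
        (trans (cong (nonzeros n *_) N≡) (trans (*-suc (nonzeros n) k) (+-comm (nonzeros n) _))))

      -- Distinct a and b contribute one fibre of the action on pairs, while a = b contributes a
      -- fibre of the action on vectors, which is k times as large. The corrections weighted by
      -- `𝟙 c` let the generic term be summed over all h² pairs, diagonal included.
      joint : ∀ a b (d : Dec (dot a w ≡ true)) (e : Dec (dot b w ≡ true)) (c : Dec (b ≡ a)) →
        frames n * ∑GL n (λ M → 𝟙 d * 𝟙 (a ᵥ· M₀ ≟ᵥ a ᵥ· M) * (𝟙 e * 𝟙 (b ᵥ· M₀ ≟ᵥ b ᵥ· M)))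
          + 𝟙 c * (𝟙 d * 𝟙 e * glOrder n) ≤ 𝟙 c * (𝟙 d * 𝟙 e * (k * glOrder n)) + 𝟙 d * 𝟙 e * glOrder n
      joint a b (no _) e c = ≤-reflexive (trans (cong₂ _+_
        (trans (cong (frames n *_) (∑GL-*ˡ n 0 λ M → 𝟙 (b ᵥ· M₀ ≟ᵥ b ᵥ· M))) (*-zeroʳ (frames n)))
        (*-zeroʳ (𝟙 c))) (sym (trans (+-identityʳ _) (*-zeroʳ (𝟙 c)))))
      joint a b (yes aw) (no _) c = ≤-reflexive (trans (cong₂ _+_
        (trans (cong (frames n *_) (trans (∑GL-cong (λ M _ → *-zeroʳ (1 * 𝟙 (a ᵥ· M₀ ≟ᵥ a ᵥ· M)))) (∑GL-*ˡ n 0 λ _ → 0))) (*-zeroʳ (frames n)))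
        (*-zeroʳ (𝟙 c))) (sym (trans (+-identityʳ _) (*-zeroʳ (𝟙 c)))))
      joint a b (yes aw) (yes bw) (yes refl) = ≤-reflexive (cong₂ _+_ (begin
        frames n * ∑GL n (λ M → 1 * 𝟙 (a ᵥ· M₀ ≟ᵥ a ᵥ· M) * (1 * 𝟙 (a ᵥ· M₀ ≟ᵥ a ᵥ· M)))
          ≡⟨ cong (frames n *_) (∑GL-cong λ M _ → idem (a ᵥ· M₀ ≟ᵥ a ᵥ· M)) ⟩
        frames n * fibre₁ a (a ᵥ· M₀)
          ≡⟨ cong (_* fibre₁ a (a ᵥ· M₀)) (trans frames≡ (*-comm (nonzeros n) k)) ⟩
        k * nonzeros n * fibre₁ a (a ᵥ· M₀)
          ≡⟨ trans (*-assoc k _ _) (cong (k *_) (nonzeros*fibre₁ a (a ᵥ· M₀) a≢0 (ᵥ·-nonzero M₀ inv₀ a≢0))) ⟩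
        k * glOrder n
          ≡⟨ sym (trans (*-identityˡ _) (*-identityˡ _)) ⟩
        1 * (1 * (k * glOrder n)) ∎) (*-identityˡ _))
        where
        open ≡-Reasoning
        a≢0 = dot≡true⇒≢0 a w aw
        idem : {P : Set} (d : Dec P) → 1 * 𝟙 d * (1 * 𝟙 d) ≡ 𝟙 d
        idem (yes _) = refl
        idem (no _)  = refl
      joint a b (yes aw) (yes bw) (no b≢a) = ≤-reflexive (begin
        frames n * ∑GL n (λ M → 1 * 𝟙 (a ᵥ· M₀ ≟ᵥ a ᵥ· M) * (1 * 𝟙 (b ᵥ· M₀ ≟ᵥ b ᵥ· M))) + 0
          ≡⟨ +-identityʳ _ ⟩
        frames n * ∑GL n (λ M → 1 * 𝟙 (a ᵥ· M₀ ≟ᵥ a ᵥ· M) * (1 * 𝟙 (b ᵥ· M₀ ≟ᵥ b ᵥ· M)))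
          ≡⟨ cong (frames n *_) (∑GL-cong {n} λ M _ → cong₂ _*_ (*-identityˡ (𝟙 (a ᵥ· M₀ ≟ᵥ a ᵥ· M))) (*-identityˡ (𝟙 (b ᵥ· M₀ ≟ᵥ b ᵥ· M)))) ⟩
        frames n * fibre₂ (a , b) (a ᵥ· M₀ , b ᵥ· M₀)
          ≡⟨ frames*fibre₂ (a , b) (a ᵥ· M₀ , b ᵥ· M₀) ind (ᵥ·-Independent M₀ inv₀ ind) ⟩
        glOrder n
          ≡⟨ sym (*-identityˡ _) ⟩
        1 * glOrder n ∎)
        where
        open ≡-Reasoning
        ind : Independent (a , b)
        ind = dot≡true⇒≢0 a w aw , dot≡true⇒≢0 b w bw , b≢a

      second-moment : frames n * ∑GL n (λ M → agreement M * agreement M) + h * glOrder n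
                      ≤ h * (k * glOrder n) + h * h * glOrder n
      second-moment = begin
        frames n * ∑GL n (λ M → agreement M * agreement M) + h * glOrder n
          ≡⟨ cong₂ _+_ expand (sym (diagonal (glOrder n))) ⟩
        ∑ (V n) (λ a → ∑ (V n) λ b → frames n * ∑GL n (λ M → χ a M * χ b M))
          + ∑ (V n) (λ a → ∑ (V n) λ b → 𝟙 (b ≟ᵥ a) * (D a * D b * glOrder n))
          ≡⟨ sym (∑∑-+ _ _) ⟩
        ∑ (V n) (λ a → ∑ (V n) λ b → frames n * ∑GL n (λ M → χ a M * χ b M) + 𝟙 (b ≟ᵥ a) * (D a * D b * glOrder n))
          ≤⟨ ∑-mono (V n) (λ a → ∑-mono (V n) λ b → joint a b (dot a w Bool.≟ true) (dot b w Bool.≟ true) (b ≟ᵥ a)) ⟩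
        ∑ (V n) (λ a → ∑ (V n) λ b → 𝟙 (b ≟ᵥ a) * (D a * D b * (k * glOrder n)) + D a * D b * glOrder n)
          ≡⟨ ∑∑-+ _ _ ⟩
        ∑ (V n) (λ a → ∑ (V n) λ b → 𝟙 (b ≟ᵥ a) * (D a * D b * (k * glOrder n)))
          + ∑ (V n) (λ a → ∑ (V n) λ b → D a * D b * glOrder n)
          ≡⟨ cong₂ _+_ (diagonal (k * glOrder n)) (trans (∑-cong (V n) λ a → ∑-*ʳ (V n) (glOrder n) _)
               (trans (∑-*ʳ (V n) (glOrder n) _) (cong (_* glOrder n) (∑-product (V n) (V n) D D)))) ⟩
        h * (k * glOrder n) + h * h * glOrder n ∎
        where
        open ≤-Reasoning
        D : Vect n → ℕ
        D a = 𝟙 (dot a w Bool.≟ true)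
        ∑∑-+ : ∀ (f g : Vect n → Vect n → ℕ) → ∑ (V n) (λ a → ∑ (V n) λ b → f a b + g a b) ≡
               ∑ (V n) (λ a → ∑ (V n) (f a)) + ∑ (V n) (λ a → ∑ (V n) (g a))
        ∑∑-+ f g = trans (∑-cong (V n) λ a → ∑-+ (V n) (f a) (g a)) (∑-+ (V n) _ _)
        idem : {P : Set} (d : Dec P) → 𝟙 d * 𝟙 d ≡ 𝟙 d
        idem (yes _) = refl
        idem (no _)  = refl
        diagonal : ∀ c → ∑ (V n) (λ a → ∑ (V n) λ b → 𝟙 (b ≟ᵥ a) * (D a * D b * c)) ≡ h * c
        diagonal c = trans (∑-cong (V n) λ a → trans (V-enumerates n a (λ b → D a * D b * c))
                              (cong (_* c) (idem (dot a w Bool.≟ true))))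
                           (∑-*ʳ (V n) c D)
        expand : frames n * ∑GL n (λ M → agreement M * agreement M) ≡
                 ∑ (V n) (λ a → ∑ (V n) λ b → frames n * ∑GL n (λ M → χ a M * χ b M))
        expand = begin-equality
          frames n * ∑GL n (λ M → agreement M * agreement M)
            ≡⟨ cong (frames n *_) (∑GL-cong λ M _ → sym (∑-product (V n) (V n) (λ a → χ a M) (λ b → χ b M))) ⟩
          frames n * ∑GL n (λ M → ∑ (V n) λ a → ∑ (V n) λ b → χ a M * χ b M)
            ≡⟨ cong (frames n *_) (trans (∑GL-∑ n (V n) _) (∑-cong (V n) λ a → ∑GL-∑ n (V n) _)) ⟩
          frames n * ∑ (V n) (λ a → ∑ (V n) λ b → ∑GL n λ M → χ a M * χ b M)
            ≡⟨ sym (trans (∑-cong (V n) λ a → ∑-*ˡ (V n) (frames n) _) (∑-*ˡ (V n) (frames n) _)) ⟩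
          ∑ (V n) (λ a → ∑ (V n) λ b → frames n * ∑GL n (λ M → χ a M * χ b M)) ∎

      moments : 3 * ∑GL n agreement + 2 * disjoint ≤ 2 * glOrder n + ∑GL n (λ M → agreement M * agreement M)
      moments = begin
        3 * ∑GL n agreement + 2 * disjoint
          ≡⟨ sym (trans (∑GL-+ n _ _) (cong₂ _+_ (∑GL-*ˡ n 3 agreement) (∑GL-*ˡ n 2 _))) ⟩
        ∑GL n (λ M → 3 * agreement M + 2 * 𝟙 (agreement M ≟ 0))
          ≤⟨ ∑GL-mono (λ M _ → bonferroni (agreement M)) ⟩
        ∑GL n (λ M → 2 + agreement M * agreement M)
          ≡⟨ trans (∑GL-+ n (λ _ → 2) _) (cong (_+ ∑GL n (λ M → agreement M * agreement M))
               (trans (∑GL-*ˡ n 2 λ _ → 1) (cong (2 *_) (sym (glOrder≡∑GL n))))) ⟩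
        2 * glOrder n + ∑GL n (λ M → agreement M * agreement M) ∎
        where open ≤-Reasoning

    disjoint-bound : 2 ≤ n → 8 * disjoint + 3 * glOrder n ≤ 8 * glOrder n
    disjoint-bound 2≤n = case h refl
      where
      open ≤-Reasoning
      2h≡ : 2 * h ≡ nonzeros n + 1
      2h≡ = trans (∑V-halfspace w w≢0) (sym (nonzeros+1 n))
      4≤2h : 4 ≤ 2 * h
      4≤2h = ≤-trans (^-monoʳ-≤ 2 2≤n) (≤-reflexive (sym (∑V-halfspace w w≢0)))
      case : ∀ m → h ≡ m → 8 * disjoint + 3 * glOrder n ≤ 8 * glOrder n
      case zero          h≡ = ⊥-elim (<⇒≱ (s≤s z≤n) (subst (λ m → 4 ≤ 2 * m) h≡ 4≤2h))
      case (suc zero)    h≡ = ⊥-elim (<⇒≱ (s≤s (s≤s (s≤s z≤n))) (subst (λ m → 4 ≤ 2 * m) h≡ 4≤2h))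
      -- With i = j + 1, h = i + 1 and 2ⁿ - 1 = 2 i + 1; n ≥ 2 gives h ≥ 2, so i is nonzero and can
      -- be cancelled.
      case (suc (suc j)) h≡ = moment-arithmetic (suc j) {Z = disjoint} N≡ (frames≡ (2 * suc j) N≡) h≡ first-moment
                                                (second-moment (2 * suc j) N≡) (moments (2 * suc j) N≡)
        where
        double : ∀ j → 2 * suc (suc j) ≡ suc (2 * suc j) + 1
        double = solve-∀
        N≡ : nonzeros n ≡ suc (2 * suc j)
        N≡ = +-cancelʳ-≡ 1 _ _ (trans (sym 2h≡) (trans (cong (2 *_) h≡) (double j)))

  -- Large n: from approximate to exact linearity

  module Large {n} (S : List (Aff n)) (uniq : Unique S) (agl : All IsAGL S) (int : IntersectingSet S)
    (R : ℕ) (S+R : length S + R ≡ glOrder n) (512R≤ : 512 * R ≤ glOrder n) (512≤2^n : 512 ≤ 2 ^ n)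
    where

    open Family S uniq agl int

    Q G N : ℕ
    Q = 2 ^ n * 2 ^ n
    G = glOrder n
    N = nonzeros n

    -- Besides (0 , 0), each nonzero x gives the three dependent pairs (x , 0), (0 , x) and (x , x).
    dependents≡ : dependents n ≡ 3 * N + 1
    dependents≡ = +-cancelʳ-≡ (frames n + N) _ _ (begin
      dependents n + (frames n + N)   ≡⟨ sym (+-assoc (dependents n) _ _) ⟩
      dependents n + frames n + N     ≡⟨ cong (_+ N) (dependents+frames n) ⟩
      2 ^ n * 2 ^ n + N               ≡⟨ cong (λ q → q * q + N) (sym (nonzeros+1 n)) ⟩
      (N + 1) * (N + 1) + N           ≡⟨ expand N ⟩
      3 * N + 1 + N * N               ≡⟨ cong (3 * N + 1 +_) (sym (frames+nonzeros n)) ⟩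
      3 * N + 1 + (frames n + N)      ∎)
      where
      open ≡-Reasoning
      expand : ∀ N → (N + 1) * (N + 1) + N ≡ 3 * N + 1 + N * N
      expand = solve-∀

    512*dependents : 512 * dependents n ≤ 3 * Q
    512*dependents = begin
      512 * dependents n       ≤⟨ *-mono-≤ 512≤2^n dependents≤ ⟩
      2 ^ n * (3 * 2 ^ n)      ≡⟨ exchange (2 ^ n) ⟩
      3 * (2 ^ n * 2 ^ n)      ∎
      where
      open ≤-Reasoning
      exchange : ∀ q → q * (3 * q) ≡ 3 * (q * q)
      exchange = solve-∀
      dependents≤ : dependents n ≤ 3 * 2 ^ n
      dependents≤ = begin
        dependents n     ≡⟨ dependents≡ ⟩
        3 * N + 1        ≤⟨ +-monoʳ-≤ (3 * N) (s≤s z≤n) ⟩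
        3 * N + 3        ≡⟨ sym (*-distribˡ-+ 3 N 1) ⟩
        3 * (N + 1)      ≡⟨ cong (3 *_) (nonzeros+1 n) ⟩
        3 * 2 ^ n        ∎

    512*∑localDefect : 512 * ∑ (VV n) (λ ab → 𝟙 (Independent? ab) * localDefect ab) ≤ Q * Q
    512*∑localDefect = begin
      512 * ∑ (VV n) (λ ab → 𝟙 (Independent? ab) * localDefect ab)
        ≡⟨ sym (∑-*ˡ (VV n) 512 _) ⟩
      ∑ (VV n) (λ ab → 512 * (𝟙 (Independent? ab) * localDefect ab))
        ≤⟨ ∑-mono (VV n) (λ ab → term ab (Independent? ab)) ⟩
      ∑ (VV n) (λ ab → 𝟙 (Independent? ab) * frames n)
        ≡⟨ ∑-*ʳ (VV n) (frames n) _ ⟩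
      frames n * frames n
        ≤⟨ *-mono-≤ (frames≤ n) (frames≤ n) ⟩
      Q * Q ∎
      where
      open ≤-Reasoning
      term : ∀ ab (d : Dec (Independent ab)) → 512 * (𝟙 d * localDefect ab) ≤ 𝟙 d * frames n
      term ab (no _)    = z≤n
      term ab (yes ind) = begin
        512 * (1 * localDefect ab)   ≡⟨ cong (512 *_) (*-identityˡ (localDefect ab)) ⟩
        512 * localDefect ab         ≤⟨ K*localDefect≤frames 512 R S+R 512R≤ ab ind ⟩
        frames n                     ≡⟨ sym (*-identityˡ _) ⟩
        1 * frames n                 ∎

    -- A share of 3/512 for dependent (a , b), the same for dependent (x , y), and 1/512 for the
    -- deficit of S.
    512*defect : 512 * defect ≤ 7 * (Q * Q)
    512*defect = begin
      512 * defect
        ≤⟨ *-monoʳ-≤ 512 defect-split ⟩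
      512 * (dependents n * order + order * dependents n + X)
        ≡⟨ cong (λ q → 512 * (dependents n * q + q * dependents n + X)) (∑VV-1 n) ⟩
      512 * (dependents n * Q + Q * dependents n + X)
        ≡⟨ regroup (dependents n) Q X ⟩
      2 * (512 * dependents n * Q) + 512 * X
        ≤⟨ +-mono-≤ (*-monoʳ-≤ 2 (*-monoˡ-≤ Q 512*dependents)) 512*∑localDefect ⟩
      2 * (3 * Q * Q) + Q * Q
        ≡⟨ collect Q ⟩
      7 * (Q * Q) ∎
      where
      open ≤-Reasoning
      X = ∑ (VV n) λ ab → 𝟙 (Independent? ab) * localDefect ab
      regroup : ∀ U Q X → 512 * (U * Q + Q * U + X) ≡ 2 * (512 * U * Q) + 512 * X
      regroup = solve-∀
      collect : ∀ Q → 2 * (3 * Q * Q) + Q * Q ≡ 7 * (Q * Q)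
      collect = solve-∀

    Q>0 : 0 < Q
    Q>0 = *-mono-≤ {1} {2 ^ n} {1} (m^n>0 2 n) (m^n>0 2 n)

    12*defect< : 12 * defect < order * order
    12*defect< = *-cancelˡ-< 512 _ _ (begin-strict
      512 * (12 * defect)      ≡⟨ exchange defect ⟩
      12 * (512 * defect)      ≤⟨ *-monoʳ-≤ 12 512*defect ⟩
      12 * (7 * (Q * Q))       ≡⟨ sym (*-assoc 12 7 (Q * Q)) ⟩
      84 * (Q * Q)             <⟨ *-monoˡ-< (Q * Q) {{>-nonZero (*-mono-≤ {1} {Q} {1} Q>0 Q>0)}} (m≤m+n 85 427) ⟩
      512 * (Q * Q)            ≡⟨ cong (λ q → 512 * (q * q)) (sym (∑VV-1 n)) ⟩
      512 * (order * order)    ∎)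
      where
      open ≤-Reasoning
      exchange : ∀ d → 512 * (12 * d) ≡ 12 * (512 * d)
      exchange = solve-∀

    512*distance : 512 * distance ≤ 35 * Q
    512*distance = *-cancelˡ-≤ Q {{>-nonZero Q>0}} (begin
      Q * (512 * distance)      ≡⟨ exchange Q distance ⟩
      512 * (Q * distance)      ≡⟨ cong (λ q → 512 * (q * distance)) (sym (∑VV-1 n)) ⟩
      512 * (order * distance)  ≤⟨ *-monoʳ-≤ 512 (majority-close (≤-trans Q>0 (≤-reflexive (sym (∑VV-1 n))))) ⟩
      512 * (5 * defect)        ≡⟨ commute defect ⟩
      5 * (512 * defect)        ≤⟨ *-monoʳ-≤ 5 512*defect ⟩
      5 * (7 * (Q * Q))         ≡⟨ collect Q ⟩
      Q * (35 * Q)              ∎)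
      where
      open ≤-Reasoning
      exchange : ∀ q d → q * (512 * d) ≡ 512 * (q * d)
      exchange = solve-∀
      commute : ∀ d → 512 * (5 * d) ≡ 5 * (512 * d)
      commute = solve-∀
      collect : ∀ q → 5 * (7 * (q * q)) ≡ q * (35 * q)
      collect = solve-∀

    deviations : Mat n → ℕ
    deviations M = ∑ (V n) λ a → 𝟙 (Nonzero? a) * 𝟙 (φ (a , a ᵥ· M) ≢? majority (a , a ᵥ· M))

    -- For a ≠ 0 the vector a M runs evenly over the nonzero x as M runs over the group, so each
    -- point where φ leaves its majority is met by at most a share 1/N of the matrices; the fibre
    -- over x = 0 is empty.
    ∑deviations : N * ∑GL n deviations ≤ distance * G
    ∑deviations = begin
      N * ∑GL n deviations
        ≡⟨ cong (N *_) (∑GL-cong λ M _ → ∑-cong (V n) λ a → sym (V-enumerates n (a ᵥ· M) (D a))) ⟩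
      N * ∑GL n (λ M → ∑ (V n) λ a → ∑ (V n) λ x → 𝟙 (x ≟ᵥ a ᵥ· M) * D a x)
        ≡⟨ cong (N *_) (trans (∑GL-∑ n (V n) _) (∑-cong (V n) λ a → ∑GL-∑ n (V n) _)) ⟩
      N * ∑ (V n) (λ a → ∑ (V n) λ x → ∑GL n λ M → 𝟙 (x ≟ᵥ a ᵥ· M) * D a x)
        ≡⟨ sym (trans (∑-cong (V n) λ a → ∑-*ˡ (V n) N _) (∑-*ˡ (V n) N _)) ⟩
      ∑ (V n) (λ a → ∑ (V n) λ x → N * ∑GL n λ M → 𝟙 (x ≟ᵥ a ᵥ· M) * D a x)
        ≤⟨ ∑-mono (V n) (λ a → ∑-mono (V n) λ x → ≤-trans
             (≤-reflexive (cong (N *_) (trans (∑GL-cong λ M _ → *-comm (𝟙 (x ≟ᵥ a ᵥ· M)) (D a x)) (∑GL-*ˡ n (D a x) _))))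
             (term a x (Nonzero? a) (x ≟ᵥ zeroVec n) (𝟙 (φ (a , x) ≢? majority (a , x))))) ⟩
      ∑ (V n) (λ a → ∑ (V n) λ x → 𝟙 (φ (a , x) ≢? majority (a , x)) * G)
        ≡⟨ sym (∑-cartesianProduct (V n) (V n) λ p → 𝟙 (φ p ≢? majority p) * G) ⟩
      ∑ (VV n) (λ p → 𝟙 (φ p ≢? majority p) * G)
        ≡⟨ ∑-*ʳ (VV n) G _ ⟩
      distance * G ∎
      where
      open ≤-Reasoning
      D : Vect n → Vect n → ℕ
      D a x = 𝟙 (Nonzero? a) * 𝟙 (φ (a , x) ≢? majority (a , x))
      exchange : ∀ N e f → N * (1 * e * f) ≡ e * (N * f)
      exchange = solve-∀
      term : ∀ a x (d : Dec (a ≢ zeroVec n)) → Dec (x ≡ zeroVec n) → ∀ e → N * (𝟙 d * e * fibre₁ a x) ≤ e * G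
      term a x (no _)    c          e = ≤-trans (≤-reflexive (*-zeroʳ N)) z≤n
      term a x (yes a≢0) (no x≢0)   e = ≤-reflexive (trans (exchange N e (fibre₁ a x))
                                          (cong (e *_) (nonzeros*fibre₁ a x a≢0 x≢0)))
      term a x (yes a≢0) (yes refl) e = ≤-trans (≤-reflexive (trans (exchange N e (fibre₁ a x))
        (trans (cong (λ f → e * (N * f)) empty) (trans (cong (e *_) (*-zeroʳ N)) (*-zeroʳ e))))) z≤n
        where
        empty : fibre₁ a (zeroVec n) ≡ 0
        empty = trans (∑GL-cong λ M inv → 𝟙-no (zeroVec n ≟ᵥ a ᵥ· M) λ eq → ᵥ·-nonzero M inv a≢0 (sym eq)) (∑GL-*ˡ n 0 λ _ → 0)

    module _ (α β : Vect n) (majority≡ : ∀ a x → majority (a , x) ≡ dot x α xor dot a β) where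

      error : Aff n → Vect n
      error (M , v) = v +ᵥ (β +ᵥ (M ·ᵥ α))

      dot-error : ∀ a g → dot a (error g) ≡ dot a (proj₂ g) xor majority (a , a ᵥ· proj₁ g)
      dot-error a (M , v) = begin
        dot a (v +ᵥ (β +ᵥ (M ·ᵥ α)))                        ≡⟨ dot-+ʳ a v _ ⟩
        dot a v xor dot a (β +ᵥ (M ·ᵥ α))                   ≡⟨ cong (dot a v xor_) (dot-+ʳ a β _) ⟩
        dot a v xor (dot a β xor dot a (M ·ᵥ α))            ≡⟨ cong (λ t → dot a v xor (dot a β xor t)) (sym (dot-ᵥ· a M α)) ⟩
        dot a v xor (dot a β xor dot (a ᵥ· M) α)            ≡⟨ cong (dot a v xor_) (trans (xor-comm (dot a β) _) (sym (majority≡ a (a ᵥ· M)))) ⟩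
        dot a v xor majority (a , a ᵥ· M)                   ∎
        where open ≡-Reasoning

      errors : ℕ
      errors = ∑ S λ g → 𝟙 (Nonzero? (error g))

      -- A nonzero error is detected by half of all rows a, and wherever it is detected the true
      -- value a · v = φ (a , a M) differs from the majority.
      error⇒deviations : ∀ {g} → g ∈ S → 2 ^ n * 𝟙 (Nonzero? (error g)) ≤ 2 * deviations (proj₁ g)
      error⇒deviations {g@(M , v)} g∈ = case (Nonzero? (error g))
        where
        open ≤-Reasoning
        case : (d : Dec (error g ≢ zeroVec n)) → 2 ^ n * 𝟙 d ≤ 2 * deviations M
        case (no _)    = ≤-trans (≤-reflexive (*-zeroʳ (2 ^ n))) z≤n
        case (yes e≢0) = begin
          2 ^ n * 1                                             ≡⟨ *-identityʳ _ ⟩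
          2 ^ n                                                 ≡⟨ sym (∑V-halfspace (error g) e≢0) ⟩
          2 * ∑ (V n) (λ a → 𝟙 (dot a (error g) Bool.≟ true))   ≤⟨ *-monoʳ-≤ 2 (∑-mono (V n) λ a →
                                                                     detect a (dot a (error g) Bool.≟ true) (Nonzero? a) (φ (a , a ᵥ· M) ≢? majority (a , a ᵥ· M))) ⟩
          2 * deviations M                                      ∎
          where
          detect : ∀ a (d : Dec (dot a (error g) ≡ true)) (e : Dec (a ≢ zeroVec n))
                   (f : Dec (φ (a , a ᵥ· M) ≢ majority (a , a ᵥ· M))) → 𝟙 d ≤ 𝟙 e * 𝟙 f
          detect a (no _)   e f = z≤n
          detect a (yes ae) e f = ≤-reflexive (sym (cong₂ _*_ (𝟙-yes e (dot≡true⇒≢0 a (error g) ae)) (𝟙-yes f deviates)))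
            where
            deviates : φ (a , a ᵥ· M) ≢ majority (a , a ᵥ· M)
            deviates eq = true≢false (trans (sym ae) (trans (dot-error a g) (trans
              (cong (_xor majority (a , a ᵥ· M)) (trans (sym (φ-value g∈ a)) eq)) (xor-same (majority (a , a ᵥ· M))))))

      -- Of the factor 4 = 140/35, one 2 comes from errors being detected by only half of the rows,
      -- the other from 2ⁿ ≤ 2 N.
      512*errors : 512 * errors ≤ 140 * G
      512*errors = *-cancelˡ-≤ (N * 2 ^ n) {{>-nonZero N2^n>0}} (begin
        N * 2 ^ n * (512 * errors)          ≡⟨ exchange₁ N (2 ^ n) errors ⟩
        512 * (N * (2 ^ n * errors))        ≤⟨ *-monoʳ-≤ 512 (*-monoʳ-≤ N total) ⟩
        512 * (N * (2 * ∑GL n deviations))  ≡⟨ exchange₂ N (∑GL n deviations) ⟩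
        1024 * (N * ∑GL n deviations)       ≤⟨ *-monoʳ-≤ 1024 ∑deviations ⟩
        1024 * (distance * G)               ≡⟨ exchange₃ distance G ⟩
        2 * (512 * distance) * G            ≤⟨ *-monoˡ-≤ G (*-monoʳ-≤ 2 512*distance) ⟩
        2 * (35 * Q) * G                    ≡⟨ exchange₄ (2 ^ n) G ⟩
        2 ^ n * 2 ^ n * (70 * G)            ≤⟨ *-monoˡ-≤ (70 * G) (*-monoˡ-≤ (2 ^ n) 2^n≤2N) ⟩
        2 * N * 2 ^ n * (70 * G)            ≡⟨ exchange₅ N (2 ^ n) G ⟩
        N * 2 ^ n * (140 * G)               ∎)
        where
        open ≤-Reasoning
        total : 2 ^ n * errors ≤ 2 * ∑GL n deviations
        total = begin
          2 ^ n * errors                                        ≡⟨ sym (∑-*ˡ S (2 ^ n) _) ⟩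
          ∑ S (λ g → 2 ^ n * 𝟙 (Nonzero? (error g)))            ≤⟨ ∑-mono-∈ S error⇒deviations ⟩
          ∑ S (λ g → 2 * deviations (proj₁ g))                  ≡⟨ ∑-*ˡ S 2 _ ⟩
          2 * ∑ S (λ g → deviations (proj₁ g))                  ≤⟨ *-monoʳ-≤ 2 (∑≤∑GL uniq agl int deviations) ⟩
          2 * ∑GL n deviations                                  ∎
        N≥1 : 1 ≤ N
        N≥1 = +-cancelʳ-≤ 1 1 N (≤-trans (m≤m+n 2 510) (≤-trans 512≤2^n (≤-reflexive (sym (nonzeros+1 n)))))
        2^n≤2N : 2 ^ n ≤ 2 * N
        2^n≤2N = begin
          2 ^ n        ≡⟨ sym (nonzeros+1 n) ⟩
          N + 1        ≤⟨ +-monoʳ-≤ N N≥1 ⟩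
          N + N        ≡⟨ cong (N +_) (sym (+-identityʳ N)) ⟩
          2 * N        ∎
        N2^n>0 : 0 < N * 2 ^ n
        N2^n>0 = *-mono-≤ {1} {N} {1} N≥1 (m^n>0 2 n)
        exchange₁ : ∀ N q e → N * q * (512 * e) ≡ 512 * (N * (q * e))
        exchange₁ = solve-∀
        exchange₂ : ∀ N d → 512 * (N * (2 * d)) ≡ 1024 * (N * d)
        exchange₂ = solve-∀
        exchange₃ : ∀ d G → 1024 * (d * G) ≡ 2 * (512 * d) * G
        exchange₃ = solve-∀
        exchange₄ : ∀ q G → 2 * (35 * (q * q)) * G ≡ q * q * (70 * G)
        exchange₄ = solve-∀
        exchange₅ : ∀ N q G → 2 * N * q * (70 * G) ≡ N * q * (140 * G)
        exchange₅ = solve-∀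

      2≤n : 2 ≤ n
      2≤n = lemma n 512≤2^n
        where
        lemma : ∀ n → 512 ≤ 2 ^ n → 2 ≤ n
        lemma 0 le = ⊥-elim (<⇒≱ (m≤m+n 2 510) le)
        lemma 1 le = ⊥-elim (<⇒≱ (m≤m+n 3 509) le)
        lemma (suc (suc n)) _ = s≤s (s≤s z≤n)

      no-errors : ∀ {g} → g ∈ S → error g ≡ zeroVec n
      no-errors {g} g∈ = decidable-stable (error g ≟ᵥ zeroVec n) λ e≢0 → contradiction e≢0
        where
        open ≤-Reasoning
        contradiction : error g ≢ zeroVec n → ⊥
        -- 4096 = 8 · 512 clears the denominators of 140/512, 5/8 and 1/512; the sum is 1120 + 2560
        -- + 8 = 3688.
        contradiction e≢0 = <⇒≱ (*-monoˡ-< G {{>-nonZero (glOrder>0 n)}} (m≤m+n 3689 407)) (begin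
          4096 * G
            ≡⟨ cong (4096 *_) (sym S+R) ⟩
          4096 * (length S + R)
            ≤⟨ *-monoʳ-≤ 4096 (+-monoˡ-≤ R covered) ⟩
          4096 * (errors + disjoint + R)
            ≡⟨ regroup errors disjoint R ⟩
          8 * (512 * errors) + (512 * (8 * disjoint) + 8 * (512 * R))
            ≤⟨ +-mono-≤ (*-monoʳ-≤ 8 512*errors) (+-mono-≤ (*-monoʳ-≤ 512 8disjoint≤) (*-monoʳ-≤ 8 512R≤)) ⟩
          8 * (140 * G) + (512 * (5 * G) + 8 * G)
            ≡⟨ collect G ⟩
          3688 * G ∎)
          where
          open Agreement (proj₁ g) (All.lookup agl g∈) (error g) e≢0
          8disjoint≤ : 8 * disjoint ≤ 5 * G
          8disjoint≤ = +-cancelʳ-≤ (3 * G) _ _ (≤-trans (disjoint-bound 2≤n) (≤-reflexive (*-distribʳ-+ G 5 3)))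
          regroup : ∀ e d r → 4096 * (e + d + r) ≡ 8 * (512 * e) + (512 * (8 * d) + 8 * (512 * r))
          regroup = solve-∀
          collect : ∀ G → 8 * (140 * G) + (512 * (5 * G) + 8 * G) ≡ 3688 * G
          collect = solve-∀
          -- An error-free g′ ∈ S shares no row a M with g whenever a detects the error of g.
          apart : ∀ {g′} → g′ ∈ S → error g′ ≡ zeroVec n → agreement (proj₁ g′) ≡ 0
          apart {g′} g′∈ e′≡0 = n≤0⇒n≡0 (≤-trans (∑-mono (V n) λ a →
            none a (dot a (error g) Bool.≟ true) (a ᵥ· proj₁ g ≟ᵥ a ᵥ· proj₁ g′)) (≤-reflexive (∑-0 (V n))))
            where
            none : ∀ a (d : Dec (dot a (error g) ≡ true)) (e : Dec (a ᵥ· proj₁ g ≡ a ᵥ· proj₁ g′)) → 𝟙 d * 𝟙 e ≤ 0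
            none a (no _)   e        = z≤n
            none a (yes _)  (no _)   = z≤n
            none a (yes ae) (yes aM) = ⊥-elim (true≢false (trans (sym ae) (trans (dot-error a g) (trans
              (cong₂ _xor_ (intersecting⇒dot≡ (int g∈ g′∈) a aM) (cong (λ x → majority (a , x)) aM))
              (trans (sym (dot-error a g′)) (trans (cong (dot a) e′≡0) (dot-zeroʳ a)))))))
          covered : length S ≤ errors + disjoint
          covered = begin
            length S
              ≡⟨ sym (∑-length S) ⟩
            ∑ S (λ _ → 1)
              ≤⟨ ∑-mono-∈ S (λ {g′} g′∈ → split g′∈ (error g′ ≟ᵥ zeroVec n)) ⟩
            ∑ S (λ g′ → 𝟙 (Nonzero? (error g′)) + 𝟙 (agreement (proj₁ g′) ≟ 0))
              ≡⟨ ∑-+ S _ _ ⟩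
            errors + ∑ S (λ g′ → 𝟙 (agreement (proj₁ g′) ≟ 0))
              ≤⟨ +-monoʳ-≤ errors (∑≤∑GL uniq agl int λ M → 𝟙 (agreement M ≟ 0)) ⟩
            errors + disjoint ∎
            where
            split : ∀ {g′} → g′ ∈ S → (d : Dec (error g′ ≡ zeroVec n)) →
                    1 ≤ 𝟙 (¬? d) + 𝟙 (agreement (proj₁ g′) ≟ 0)
            split g′∈ (no _)    = s≤s z≤n
            split g′∈ (yes e≡0) = ≤-reflexive (sym (𝟙-yes (agreement _ ≟ 0) (apart g′∈ e≡0)))

      canonical : All (λ g → act g α ≡ β) S
      canonical = canonical⇒ α β λ {g} g∈ a _ → begin
        φ (a , a ᵥ· proj₁ g)                       ≡⟨ φ-value g∈ a ⟩
        dot a (proj₂ g)                            ≡⟨ sym (xor-cancelʳ _ (majority (a , a ᵥ· proj₁ g))) ⟩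
        (dot a (proj₂ g) xor majority (a , a ᵥ· proj₁ g)) xor majority (a , a ᵥ· proj₁ g)
                                                   ≡⟨ cong (_xor majority (a , a ᵥ· proj₁ g)) (trans (sym (dot-error a g)) (trans (cong (dot a) (no-errors g∈)) (dot-zeroʳ a))) ⟩
        majority (a , a ᵥ· proj₁ g)                ≡⟨ majority≡ a (a ᵥ· proj₁ g) ⟩
        dot (a ᵥ· proj₁ g) α xor dot a β           ∎
        where open ≡-Reasoning

    large-canonical : ∃₂ λ α β → All (λ g → act g α ≡ β) S
    large-canonical = combine (additive⇒dot₂ majority (majority-additive 12*defect<))
      where
      combine : (∃₂ λ α β → ∀ a x → majority (a , x) ≡ dot x α xor dot a β) → ∃₂ λ α β → All (λ g → act g α ≡ β) S
      combine (α , β , majority≡) = α , β , canonical α β majority≡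

  -- Joining the two ranges of n

  exact⇒dot : ∀ {n} → 1 ≤ n → (φ : Vect n × Vect n → Bool) →
    (∀ a b x y → Independent (a , b) → Independent (x , y) → φ ((a , x) ⊞ (b , y)) ≡ φ (a , x) xor φ (b , y)) →
    ∃₂ λ α β → ∀ a x → a ≢ zeroVec n → x ≢ zeroVec n → φ (a , x) ≡ dot x α xor dot a β
  exact⇒dot {suc (suc n)} _ φ loc = bilocal⇒dot φ loc
  -- Dimension 1 has no independent pairs and only one nonzero vector, so α = 0 and a β storing the
  -- single relevant value of φ suffice.
  exact⇒dot {suc zero}    _ φ loc = false ∷ [] , φ (true ∷ [] , true ∷ []) ∷ [] , λ
    { (true  ∷ []) (true  ∷ []) _   _   → sym (xor-identityʳ _)
    ; (false ∷ []) _            a≢0 _   → ⊥-elim (a≢0 refl)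
    ; (true  ∷ []) (false ∷ []) _   x≢0 → ⊥-elim (x≢0 refl) }

  -- Turns a lower bound on the size of S into an upper bound on its deficit, using (k + 1) m - k m
  -- = m.
  complement-bound : ∀ k {m s} → k * m ≤ suc k * s → suc k * (m ∸ s) ≤ m
  complement-bound k {m} {s} le = begin
    suc k * (m ∸ s)           ≡⟨ *-distribˡ-∸ (suc k) m s ⟩
    suc k * m ∸ suc k * s     ≤⟨ ∸-monoʳ-≤ (suc k * m) le ⟩
    suc k * m ∸ k * m         ≡⟨ m+n∸n≡m m (k * m) ⟩
    m                         ∎
    where open ≤-Reasoning

  -- For n ≤ 8 there are at most 4⁸ ≤ k independent pairs, too few for any local equation to fail.
  canonical-of-size : ∀ k → 2 ^ 8 * 2 ^ 8 ≤ k → 512 ≤ suc k → ∀ {n} → 1 ≤ n →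
                      (S : List (Aff n)) → Unique S → All IsAGL S → IntersectingSet S →
                      k * glOrder n ≤ suc k * length S → ∃₂ λ α β → All (λ g → act g α ≡ β) S
  canonical-of-size k 4⁸≤k 512≤1+k {n} 1≤n S uniq agl int size = either (n ≤? 8)
    where
    open Family S uniq agl int
    R : ℕ
    R = glOrder n ∸ length S
    S+R : length S + R ≡ glOrder n
    S+R = m+[n∸m]≡n length≤glOrder
    KR≤ : suc k * R ≤ glOrder n
    KR≤ = complement-bound k size
    exact : (∃₂ λ α β → ∀ a x → a ≢ zeroVec n → x ≢ zeroVec n → φ (a , x) ≡ dot x α xor dot a β) →
            ∃₂ λ α β → All (λ g → act g α ≡ β) S
    exact (α , β , φ≡) = α , β , canonical⇒ α β λ {g} g∈ a a≢0 →
      φ≡ a (a ᵥ· proj₁ g) a≢0 (ᵥ·-nonzero (proj₁ g) (All.lookup agl g∈) a≢0)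
    either : Dec (n ≤ 8) → ∃₂ λ α β → All (λ g → act g α ≡ β) S
    either (yes n≤8) = exact (exact⇒dot 1≤n φ (φ-bilocal (suc k) R S+R KR≤
      (s≤s (≤-trans (frames≤ n) (≤-trans (*-mono-≤ (^-monoʳ-≤ 2 n≤8) (^-monoʳ-≤ 2 n≤8)) 4⁸≤k)))))
    either (no n≰8)  = Large.large-canonical S uniq agl int R S+R
      -- Here n ≥ 9, and 2⁹ = 512.
      (≤-trans (*-monoˡ-≤ R 512≤1+k) KR≤) (^-monoʳ-≤ 2 (≰⇒> n≰8))

-- The constant as a rational number

open import Data.Integer using (+_; +<+)
open import Data.Rational using (ℚ; _/_; _*_; _<_; _≤_; 1ℚ; toℚᵘ)

k/1+k<1 : ∀ k → (+ k) / suc k < 1ℚ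
k/1+k<1 k = ℚ.toℚᵘ-cancel-< (ℚᵘ.<-respˡ-≃ (ℚᵘ.≃-sym (ℚ.toℚᵘ-fromℚᵘ (ℚᵘ.mkℚᵘ (+ k) k)))
  (ℚᵘ.*<* (subst₂ ℤ._<_ (sym (ℤ.*-identityʳ (+ k))) (sym (ℤ.*-identityˡ (+ suc k))) (+<+ (ℕ.n<1+n k)))))

-- A quotient in ℚ is stored in lowest terms, so the comparison is moved to unnormalised fractions,
-- where the given numerators and denominators are visible and can be cross-multiplied.
scaled-≤ : ∀ k m s → ((+ k) / suc k) * ((+ m) / 1) ≤ (+ s) / 1 → k ℕ.* m ℕ.≤ suc k ℕ.* s
scaled-≤ k m s le with ℚᵘ.≤-respˡ-≃ product (ℚᵘ.≤-respʳ-≃ (ℚ.toℚᵘ-fromℚᵘ (ℚᵘ.mkℚᵘ (+ s) 0)) (ℚ.toℚᵘ-mono-≤ le))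
  where
  product : toℚᵘ (((+ k) / suc k) * ((+ m) / 1)) ℚᵘ.≃ ℚᵘ.mkℚᵘ (+ k) k ℚᵘ.* ℚᵘ.mkℚᵘ (+ m) 0
  product = ℚᵘ.≃-trans (ℚ.toℚᵘ-homo-* ((+ k) / suc k) ((+ m) / 1))
    (ℚᵘ.*-cong (ℚ.toℚᵘ-fromℚᵘ (ℚᵘ.mkℚᵘ (+ k) k)) (ℚ.toℚᵘ-fromℚᵘ (ℚᵘ.mkℚᵘ (+ m) 0)))
... | ℚᵘ.*≤* cross = ℤ.drop‿+≤+ (begin
  + (k ℕ.* m)                        ≡⟨ ℤ.pos-* k m ⟩
  + k ℤ.* + m                        ≡⟨ sym (ℤ.*-identityʳ _) ⟩
  + k ℤ.* + m ℤ.* + 1                ≤⟨ cross ⟩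
  + s ℤ.* + (suc k ℕ.* 1)            ≡⟨ cong (λ t → + s ℤ.* + t) (ℕ.*-identityʳ (suc k)) ⟩
  + s ℤ.* + suc k                    ≡⟨ trans (ℤ.*-comm (+ s) (+ suc k)) (sym (ℤ.pos-* (suc k) s)) ⟩
  + (suc k ℕ.* s)                    ∎)
  where open ℤ.≤-Reasoning

theorem1p5 : Σ ℚ λ c₀ → (c₀ < 1ℚ) ×
    ((n : ℕ) → n ≥ 1 → (S : List (Aff n)) → Unique S → All IsAGL S →
    IntersectingSet S →
    c₀ * ((+ glOrder n) / 1) ≤ (+ length S) / 1 →
    Σ (Vect n) λ α → Σ (Vect n) λ β → All (λ g → act g α ≡ β) S)
theorem1p5 = (+ k) / suc k , k/1+k<1 k , λ n n≥1 S uniq agl int size →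
  canonical-of-size k ℕ.≤-refl (ℕ.m≤m+n 512 _) n≥1 S uniq agl int (scaled-≤ k (glOrder n) (length S) size)
  where
  k : ℕ
  -- This is 4⁸, the bound on the number of frames for n ≤ 8; thus c₀ = 65536/65537.
  k = 65536
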